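{- Let $\theta>0$. Let $w=(w_k)_{k\ge1}$ be a real sequence, put $a_1=w_1$, and put $a_j=w_j-w_{j-1}$ for $j\ge2$. Suppose that $a_1\ne0$, that $a=(a_j)_{j\ge1}\in\ell^1_\theta$, and that the Dirichlet inverse $b=a^{(-1)}$, characterized by $a\ast b=e$ with $e_1=1$ and $e_j=0$ for $j\ge2$, also belongs to $\ell^1_\theta$. Define \[ \mathcal T_w(G_x)=\sum_{k\ge1}w_k s_k(G_x),\qquad \mathcal M_w(x)=\sum_{k\ge1}w_k\left(\operatorname{Li}(x/k)-\operatorname{Li}(x/(k+1))\right). \] Then for every $m\ge0$, \[ \pi(x)-\operatorname{Li}(x)=O\!\left(x^\theta\log^m(ex)\right) \] if and only if \[ \mathcal T_w(G_x)-\mathcal M_w(x)=O\!\left(x^\theta\log^m(ex)\right). \] The hypotheses on $b$ hold, in particular, whenever \[ \kappa_\theta=\frac{1}{|a_1|}\sum_{j=2}^\infty\frac{|a_j|}{j^\theta}<1 . \]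
   Context: For an integer $n\ge2$, $G_n$ is the simple graph with vertex set $\{2,\ldots,n\}$ in which two distinct vertices $x,y$ are adjacent if and only if $\gcd(x,y)>1$; for real $x\ge2$, $G_x=G_{\lfloor x\rfloor}$. A vertex is simplicial if its open neighborhood induces a clique (possibly empty). Two vertices are true twins if their closed neighborhoods are equal; simpliciality and degree are constant on each true-twin class. For $k\ge1$, $s_k(G_x)$ is the number of true-twin classes of simplicial vertices of $G_x$ whose common degree is $k-1$. For a sequence $c=(c_j)_{j\ge1}$, $\|c\|_{\ell^1_\theta}=\sum_{j\ge1}|c_j|j^{ -\theta}$, and $\ell^1_\theta$ is the space of sequences with finite norm. Dirichlet convolution is $(c\ast d)_n=\sum_{r\mid n}c_r d_{n/r}$. $\pi(x)$ is the number of primes at most $x$; $\operatorname{Li}(x)=\int_2^x\frac{dt}{\log t}$ for $x\ge2$, and $\operatorname{Li}(x)=\pi(x)=0$ for $x<2$. For each $x$ the sums defining $\mathcal T_w(G_x)$ and $\mathcal M_w(x)$ have only finitely many nonzero terms. The $O$-estimates are for all real $x\ge2$. -}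

module Defs where

open import Level using (0ℓ)
open import Algebra.Core using (Op₁; Op₂)
open import Algebra.Structures using (IsCommutativeRing)
open import Axiom.ExcludedMiddle using (ExcludedMiddle)
open import Data.Fin.Base using (Fin; toℕ)
open import Data.Fin.Properties using (all?) renaming (_≟_ to _≟ᶠ_)
open import Data.List.Base using (length; filter; deduplicate; allFin; upTo)
open import Data.Nat.Base as ℕ using (ℕ; zero; suc)
open import Data.Nat.Divisibility using (_∣?_; divides)
open import Data.Nat.GCD using (gcd; gcd-comm)
open import Data.Nat.Primality using (prime?)
import Data.Nat.Properties as ℕₚ
open import Data.Product.Base using (∃; _×_; _,_)
open import Data.Sum.Base using (_⊎_)
open import Function.Base using (flip; _∘_)
open import Function.Bundles using (_⇔_; mk⇔; Equivalence)
open import Relation.Binary.Core using (Rel)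
open import Relation.Binary.Definitions using (Decidable; Symmetric; Irreflexive)
open import Relation.Binary.Structures using (IsTotalOrder)
open import Relation.Binary.PropositionalEquality.Core using (_≡_; _≢_; refl; sym; subst)
open import Relation.Nullary.Decidable using (Dec; yes; no; ¬?; _×-dec_; _⊎-dec_; _→-dec_; map′)
import Relation.Unary as U

------------------------------------------------------------------------
-- Finite simple graphs

record SimpleGraph (n : ℕ) : Set₁ where
  field
    Adj        : Rel (Fin n) 0ℓ
    adj?       : Decidable Adj
    adj-sym    : Symmetric Adj
    adj-irrefl : Irreflexive _≡_ Adj

  degree : Fin n → ℕ
  degree v = length (filter (adj? v) (allFin n))

  Simplicial : Fin n → Set
  Simplicial v = ∀ x y → Adj v x → Adj v y → x ≢ y → Adj x y

  _∈N[_] : Fin n → Fin n → Set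
  x ∈N[ v ] = x ≡ v ⊎ Adj v x

  TrueTwins : Rel (Fin n) 0ℓ
  TrueTwins u v = ∀ x → x ∈N[ u ] ⇔ x ∈N[ v ]

  simplicial? : U.Decidable Simplicial
  simplicial? v = all? λ x → all? λ y →
    adj? v x →-dec adj? v y →-dec ¬? (x ≟ᶠ y) →-dec adj? x y

  _∈N[_]? : ∀ x v → Dec (x ∈N[ v ])
  x ∈N[ v ]? = (x ≟ᶠ v) ⊎-dec adj? v x

  trueTwins? : Decidable TrueTwins
  trueTwins? u v = all? λ x →
    map′ (λ (f , g) → mk⇔ f g) (λ e → Equivalence.to e , Equivalence.from e)
      (((x ∈N[ u ]?) →-dec (x ∈N[ v ]?)) ×-dec ((x ∈N[ v ]?) →-dec (x ∈N[ u ]?)))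

  -- `deduplicate` keeps exactly one representative of each true-twin class.
  s : ℕ → ℕ
  s k = length (deduplicate trueTwins?
          (filter (λ v → simplicial? v ×-dec (suc (degree v) ℕₚ.≟ k)) (allFin n)))

label : ∀ {n} → Fin n → ℕ
label i = 2 ℕ.+ toℕ i

-- The n ∸ 1 vertices are labelled 2, …, n.
gcdGraph : ∀ n → SimpleGraph (n ℕ.∸ 1)
gcdGraph n = record
  { Adj        = λ x y → x ≢ y × 1 ℕ.< gcd (label x) (label y)
  ; adj?       = λ x y → ¬? (x ≟ᶠ y) ×-dec (1 ℕₚ.<? gcd (label x) (label y))
  ; adj-sym    = λ {x} {y} (x≢y , 1<g) →
                   x≢y ∘ sym , subst (1 ℕ.<_) (gcd-comm (label x) (label y)) 1<g
  ; adj-irrefl = λ x≡y (x≢y , _) → x≢y x≡y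
  }

------------------------------------------------------------------------
-- The real numbers, axiomatised up to isomorphism as a complete ordered field

module _ {A : Set} (_≤_ : Rel A 0ℓ) where

  IsUpperBound IsSup : (A → Set) → A → Set
  IsUpperBound S u = ∀ x → S x → x ≤ u
  IsSup S u = IsUpperBound S u × (∀ v → IsUpperBound S v → u ≤ v)

record CompleteOrderedField : Set₁ where
  infix  4 _≤_ _<_
  infixl 6 _+_ _-_
  infixl 7 _*_ _/_
  infix  8 -_
  infix  9 _⁻¹
  field
    ℝ                 : Set
    _≤_               : Rel ℝ 0ℓ
    _+_ _*_           : Op₂ ℝ
    -_ _⁻¹            : Op₁ ℝ
    0# 1#             : ℝ
    isCommutativeRing : IsCommutativeRing _≡_ _+_ _*_ -_ 0# 1#
    0≢1               : 0# ≢ 1#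
    -- 0# ⁻¹ is unconstrained.
    ⁻¹-inverseʳ       : ∀ x → x ≢ 0# → x * x ⁻¹ ≡ 1#
    isTotalOrder      : IsTotalOrder _≡_ _≤_
    +-monoˡ-≤         : ∀ z {x y} → x ≤ y → x + z ≤ y + z
    *-nonNeg          : ∀ {x y} → 0# ≤ x → 0# ≤ y → 0# ≤ x * y

    complete          : ∀ S → ∃ S → ∃ (IsUpperBound _≤_ S) → ∃ (IsSup _≤_ S)

  _-_ _/_ : Op₂ ℝ
  x - y = x + (- y)
  x / y = x * y ⁻¹

  _<_ : Rel ℝ 0ℓ
  x < y = x ≤ y × x ≢ y

------------------------------------------------------------------------
-- Classical analysis over the reals

module Analysis (em : ExcludedMiddle 0ℓ) (R : CompleteOrderedField) where

  open CompleteOrderedField R public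

  -- Definite description, with junk value 0# if no such real exists; it is
  -- applied only to predicates satisfied by at most one real.
  the : (ℝ → Set) → ℝ
  the P with em {∃ P}
  ... | yes (x , _) = x
  ... | no  _       = 0#

  fromℕ : ℕ → ℝ
  fromℕ zero    = 0#
  fromℕ (suc n) = fromℕ n + 1#

  2# : ℝ
  2# = fromℕ 2

  ∣_∣ : ℝ → ℝ
  ∣ x ∣ with em {0# ≤ x}
  ... | yes _ = x
  ... | no  _ = - x

  -- ⌊ x ⌋ is 0 for negative x.
  ⌊_⌋ : ℝ → ℕ
  ⌊ x ⌋ with em {∃ λ n → fromℕ n ≤ x × x < fromℕ (suc n)}
  ... | yes (n , _) = n
  ... | no  _       = 0

  -- Integrals over [ a , b ] of the step functions lying ≲ f.
  data StepSum (_≲_ : Rel ℝ 0ℓ) (f : ℝ → ℝ) : ℝ → ℝ → ℝ → Set where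
    stop : ∀ {a} → StepSum _≲_ f a a 0#
    step : ∀ {a t b c σ} → a ≤ t → (∀ u → a ≤ u → u ≤ t → c ≲ f u) →
           StepSum _≲_ f t b σ → StepSum _≲_ f a b (c * (t - a) + σ)

  -- The Darboux (Riemann) integral, for a ≤ b: the supremum of the lower sums is
  -- the infimum of the upper sums.
  IsIntegral : (ℝ → ℝ) → ℝ → ℝ → ℝ → Set
  IsIntegral f a b I =
    IsSup _≤_ (StepSum _≤_ f a b) I × IsSup (flip _≤_) (StepSum (flip _≤_) f a b) I

  ∫ : ℝ → ℝ → (ℝ → ℝ) → ℝ
  ∫ a b f = the (IsIntegral f a b)

  -- The natural logarithm, for x > 0.
  log : ℝ → ℝ
  log x with em {1# ≤ x}
  ... | yes _ = ∫ 1# x _⁻¹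
  ... | no  _ = - ∫ x 1# _⁻¹

  exp : ℝ → ℝ
  exp y = the λ x → 0# < x × log x ≡ y

  e : ℝ
  e = exp 1#

  -- Real powers of a positive base.
  infixr 8 _^_
  _^_ : ℝ → ℝ → ℝ
  x ^ y = exp (y * log x)

  Li : ℝ → ℝ
  Li x with em {2# ≤ x}
  ... | yes _ = ∫ 2# x (λ t → log t ⁻¹)
  ... | no  _ = 0#

  π : ℝ → ℕ
  π x = length (filter prime? (upTo (suc ⌊ x ⌋)))

  -- A sequence (c_j)_{j ≥ 1} is a function on ℕ whose value at 0 is ignored.
  Seq : Set
  Seq = ℕ → ℝ

  -- ∑ N c is the sum of c j over 1 ≤ j ≤ N.
  ∑ : ℕ → Seq → ℝ
  ∑ zero    c = 0#
  ∑ (suc N) c = ∑ N c + c (suc N)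

  HasSum : Seq → ℝ → Set
  HasSum c S = ∀ ε → 0# < ε → ∃ λ N → ∀ n → N ℕ.≤ n → ∣ ∑ n c - S ∣ < ε

  ∑∞ : Seq → ℝ
  ∑∞ c = the (HasSum c)

  infix 4 _∈ℓ¹_
  _∈ℓ¹_ : Seq → ℝ → Set
  c ∈ℓ¹ θ = ∃ (HasSum λ j → ∣ c j ∣ * fromℕ j ^ (- θ))

  infixl 7 _∗_
  _∗_ : Seq → Seq → Seq
  (c ∗ d) n = ∑ n term
    where
    term : Seq
    term r with r ∣? n
    ... | yes (divides q _) = c r * d q   -- q = n / r
    ... | no  _             = 0#

  unit : Seq
  unit 1 = 1#
  unit _ = 0#

  IsDirichletInverse : Seq → Seq → Set
  IsDirichletInverse a b = ∀ n → 1 ℕ.≤ n → (a ∗ b) n ≡ unit n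

  differences : Seq → Seq
  differences w 0             = 0#
  differences w 1             = w 1
  differences w (suc (suc j)) = w (suc (suc j)) - w (suc j)

  𝒯 : Seq → ℝ → ℝ
  𝒯 w x = ∑∞ λ k → w k * fromℕ (SimpleGraph.s (gcdGraph ⌊ x ⌋) k)

  ℳ : Seq → ℝ → ℝ
  ℳ w x = ∑∞ λ k → w k * (Li (x / fromℕ k) - Li (x / fromℕ (suc k)))

  -- The series over j ≥ 2 is reindexed to start at 1.
  κ : ℝ → Seq → ℝ
  κ θ a = ∣ a 1 ∣ ⁻¹ * ∑∞ λ j → ∣ a (suc j) ∣ / fromℕ (suc j) ^ θ

  infix 4 _=O_
  _=O_ : (ℝ → ℝ) → (ℝ → ℝ) → Set
  f =O g = ∃ λ C → ∀ x → 2# ≤ x → ∣ f x ∣ ≤ C * g x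

{-# OPTIONS --safe #-}
-- A vertex with two distinct prime divisors p, q has the non-adjacent neighbours p and q, so the
-- simplicial vertices are the powers of a prime p, with closed neighbourhood the multiples of p.
-- Thus s_k(G_x) counts the primes p with ⌊x/p⌋ = k, i.e. s_k(G_x) = π(x/k) − π(x/(k+1)), and Abel
-- summation gives 𝒯_w(G_x) − ℳ_w(x) = Σ_k a_k Δ(x/k) with Δ = π − Li, which vanishes below 2.
-- Dirichlet inversion turns this into Δ(x) = Σ_k b_k (𝒯_w − ℳ_w)(x/k). Each of the two transforms
-- preserves O(g) for g(x) = x^θ log^m(ex), since g(x/k) ≤ k^{-θ} g(x) and a, b ∈ ℓ¹_θ.
-- If κ_θ < 1, the partial sums B of Σ |b_j| j^{-θ} satisfy |a₁| B ≤ 1 + κ_θ |a₁| B, so b ∈ ℓ¹_θ.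
module Submission where

open import Defs
open import Level using (0ℓ)
open import Axiom.ExcludedMiddle using (ExcludedMiddle)
open import Data.Product.Base using (∃; _×_; _,_; proj₁; proj₂)
open import Function.Bundles using (_⇔_; mk⇔; Equivalence)
open import Relation.Binary.PropositionalEquality.Core using (_≢_)

open import Algebra.Bundles using (CommutativeRing)
import Algebra.Solver.Ring as RingSolver
open import Algebra.Solver.Ring.AlmostCommutativeRing using (fromCommutativeRing; _-Raw-AlmostCommutative⟶_)
open import Algebra.Structures using (IsCommutativeRing)
open import Data.Empty using (⊥-elim)
open import Data.Fin.Base using (Fin; fromℕ<)
import Data.Fin.Properties as Finₚ
open import Data.Integer.Base as ℤ using (ℤ)
import Data.Integer.Properties as ℤₚ
open import Data.List.Base using (List; []; _∷_; _++_; length; map; filter; deduplicate; allFin; upTo)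
open import Data.List.Membership.Propositional using (_∈_; find)
import Data.List.Membership.Propositional.Properties as ∈ₚ
open import Data.List.Membership.Propositional.Properties.WithK using (unique∧set⇒bag)
open import Data.List.Properties using (length-map; length-++; length-upTo)
open import Data.List.Relation.Binary.BagAndSetEquality using (∼bag⇒↭)
open import Data.List.Relation.Binary.Permutation.Propositional.Properties using (↭-length)
open import Data.List.Relation.Unary.All as All using (All; []; _∷_)
import Data.List.Relation.Unary.All.Properties as Allₚ
open import Data.List.Relation.Unary.AllPairs using (AllPairs; []; _∷_)
import Data.List.Relation.Unary.AllPairs.Properties as AllPairsₚ
open import Data.List.Relation.Unary.Any as Any using (here; there)
import Data.List.Relation.Unary.Any.Properties as Anyₚ
open import Data.List.Relation.Unary.Unique.Propositional using (Unique)
import Data.List.Relation.Unary.Unique.Propositional.Properties as Uniqueₚ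
open import Data.Maybe.Base as Maybe using (Maybe)
import Data.Nat.Base as ℕ
open import Data.Nat.Base using (ℕ; zero; suc; z≤n; s≤s)
open import Data.Nat.Divisibility using (_∣?_; divides)
import Data.Nat.DivMod as ℕ
open import Data.Nat.GCD using (gcd; gcd[m,n]∣m; gcd[m,n]∣n; gcd-greatest; gcd[m,n]≢0)
open import Data.Nat.ListAction using (product)
open import Data.Nat.Primality using (Prime; prime?; prime⇒nonZero; prime⇒nonTrivial; prime⇒irreducible)
open import Data.Nat.Primality.Factorisation using (factorise; module PrimeFactorisation)
import Data.Nat.Properties as ℕₚ
import Data.Sign.Base as Sign
open import Data.Sum.Base using (_⊎_; inj₁; inj₂; [_,_]′)
open import Function.Base using (flip; _∘_)
open import Relation.Binary.Bundles using (Poset)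
import Relation.Binary.Construct.NonStrictToStrict as ToStrict
open import Relation.Binary.Core using (Rel)
open import Relation.Binary.Definitions using (Decidable)
open import Relation.Binary.PropositionalEquality using (_≡_; refl; sym; trans; cong; cong₂; subst; subst₂)
open import Relation.Binary.Structures using (IsTotalOrder)
open import Relation.Nullary using (¬_; yes; no)
open import Relation.Nullary.Decidable using (¬?; _×-dec_; dec⇒maybe)

-- The vanishing of π - Li below 2 turns every series at x into a finite sum, and any cut-off from
-- ⌊x⌋ on is admissible. As x/j ≤ x, one cut-off serves the outer sum and all inner sums at the
-- points x/j, so composing two transforms gives a sum over a square of index pairs, where the order
-- of summation is free and a ∗ b = e can be read off. The same square, with nonnegative entries,
-- makes the truncated weighted norms submultiplicative. The estimate for κ_θ < 1 is therefore an
-- inequality between finite partial sums, in which the term κ_θ |a₁| B may be subtracted. The reals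
-- are given by axioms only, so the logarithm has to be developed from its Darboux integral:
-- bisection shows 1/t integrable, additivity and invariance under dilation give log(xy) = log x +
-- log y, and surjectivity of log provides exp and real powers. The exponent m ranges over the
-- nonnegative reals, so log^m(ex) is a real power, whose base is at least 1 for x ≥ 1.

-- The ring solver with integer coefficients, so that x - x cancels.
module IntegerSolver (R : CommutativeRing 0ℓ 0ℓ) where

  open CommutativeRing R renaming (refl to ≈-refl; sym to ≈-sym; trans to ≈-trans; reflexive to ≈-reflexive)
  open import Data.Integer.Base using (+_; -[1+_])
  open import Algebra.Properties.Ring ring
  open import Algebra.Properties.AbelianGroup +-abelianGroup using (⁻¹-∙-comm; ε⁻¹≈ε; ⁻¹-involutive)
  open import Algebra.Properties.Semiring.Mult.TCOptimised semiring using (×-homo-+; ×1-homo-*; 1+×) renaming (_×_ to infixr 8 _·_)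
  open import Relation.Binary.Reasoning.Setoid setoid

  -- With this variant of multiples `1 · 1#` reduces to `1#`, so `:0` and `:1` match `0#` and `1#`
  -- in a goal by computation.
  ⟦_⟧ : ℤ → Carrier
  ⟦ + n ⟧      = n · 1#
  ⟦ -[1+ n ] ⟧ = - (suc n · 1#)

  -‿homo : ∀ i → ⟦ ℤ.- i ⟧ ≈ - ⟦ i ⟧
  -‿homo (+ zero)  = ≈-sym ε⁻¹≈ε
  -‿homo (+ suc n) = ≈-refl
  -‿homo -[1+ n ]  = ≈-sym (⁻¹-involutive _)

  cancel : ∀ x y z → x + y - (x + z) ≈ y - z
  cancel x y z = begin
    x + y + - (x + z)      ≈⟨ +-cong (+-comm x y) (≈-sym (⁻¹-∙-comm x z)) ⟩
    y + x + (- x + - z)    ≈⟨ +-assoc y x _ ⟩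
    y + (x + (- x + - z))  ≈⟨ +-congˡ (≈-sym (+-assoc x _ _)) ⟩
    y + (x + - x + - z)    ≈⟨ +-congˡ (+-congʳ (-‿inverseʳ x)) ⟩
    y + (0# + - z)         ≈⟨ +-congˡ (+-identityˡ _) ⟩
    y + - z                ∎

  ⊖-homo : ∀ m n → ⟦ m ℤ.⊖ n ⟧ ≈ m · 1# - n · 1#
  ⊖-homo zero    zero    = ≈-sym (-‿inverseʳ 0#)
  ⊖-homo zero    (suc n) = ≈-sym (+-identityˡ _)
  ⊖-homo (suc m) zero    = ≈-sym (≈-trans (+-congˡ ε⁻¹≈ε) (+-identityʳ _))
  ⊖-homo (suc m) (suc n) = begin
    ⟦ suc m ℤ.⊖ suc n ⟧                ≡⟨ cong ⟦_⟧ (ℤₚ.[1+m]⊖[1+n]≡m⊖n m n) ⟩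
    ⟦ m ℤ.⊖ n ⟧                        ≈⟨ ⊖-homo m n ⟩
    m · 1# - n · 1#                    ≈⟨ cancel 1# _ _ ⟨
    1# + m · 1# - (1# + n · 1#)        ≈⟨ +-cong (1+× m 1#) (-‿cong (1+× n 1#)) ⟨
    suc m · 1# - suc n · 1#            ∎

  +-homo : ∀ i j → ⟦ i ℤ.+ j ⟧ ≈ ⟦ i ⟧ + ⟦ j ⟧
  +-homo (+ m)    (+ n)    = ×-homo-+ 1# m n
  +-homo (+ m)    -[1+ n ] = ⊖-homo m (suc n)
  +-homo -[1+ m ] (+ n)    = ≈-trans (⊖-homo n (suc m)) (+-comm _ _)
  +-homo -[1+ m ] -[1+ n ] = begin
    - (suc (suc (m ℕ.+ n)) · 1#)         ≈⟨ -‿cong (1+× (suc (m ℕ.+ n)) 1#) ⟩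
    - (1# + (suc m ℕ.+ n) · 1#)          ≈⟨ -‿cong (+-congˡ (×-homo-+ 1# (suc m) n)) ⟩
    - (1# + (suc m · 1# + n · 1#))       ≈⟨ -‿cong (+-assoc 1# _ _) ⟨
    - (1# + suc m · 1# + n · 1#)         ≈⟨ -‿cong (+-congʳ (+-comm 1# _)) ⟩
    - (suc m · 1# + 1# + n · 1#)         ≈⟨ -‿cong (+-assoc _ 1# _) ⟩
    - (suc m · 1# + (1# + n · 1#))       ≈⟨ -‿cong (+-congˡ (1+× n 1#)) ⟨
    - (suc m · 1# + suc n · 1#)          ≈⟨ ⁻¹-∙-comm _ _ ⟨
    - (suc m · 1#) - suc n · 1#          ∎

  -◃-homo : ∀ n → ⟦ Sign.- ℤ.◃ n ⟧ ≈ - (n · 1#)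
  -◃-homo zero    = ≈-sym ε⁻¹≈ε
  -◃-homo (suc n) = ≈-refl

  +◃-homo : ∀ n → ⟦ Sign.+ ℤ.◃ n ⟧ ≈ n · 1#
  +◃-homo n = ≈-reflexive (cong ⟦_⟧ (ℤₚ.+◃n≡+n n))

  *-homo : ∀ i j → ⟦ i ℤ.* j ⟧ ≈ ⟦ i ⟧ * ⟦ j ⟧
  *-homo (+ m)    (+ n)    = ≈-trans (+◃-homo (m ℕ.* n)) (×1-homo-* m n)
  *-homo (+ m)    -[1+ n ] = ≈-trans (-◃-homo (m ℕ.* suc n)) (≈-trans (-‿cong (×1-homo-* m (suc n))) (-‿distribʳ-* _ _))
  *-homo -[1+ m ] (+ n)    = ≈-trans (-◃-homo (suc m ℕ.* n)) (≈-trans (-‿cong (×1-homo-* (suc m) n)) (-‿distribˡ-* _ _))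
  *-homo -[1+ m ] -[1+ n ] = begin
    (suc m ℕ.* suc n) · 1#             ≈⟨ ×1-homo-* (suc m) (suc n) ⟩
    (suc m · 1#) * (suc n · 1#)        ≈⟨ ⁻¹-involutive _ ⟨
    - - ((suc m · 1#) * (suc n · 1#))  ≈⟨ -‿cong (-‿distribʳ-* _ _) ⟩
    - ((suc m · 1#) * - (suc n · 1#))  ≈⟨ -‿distribˡ-* _ _ ⟩
    - (suc m · 1#) * - (suc n · 1#)    ∎

  morphism : ℤ.+-*-rawRing -Raw-AlmostCommutative⟶ fromCommutativeRing R
  morphism = record
    { ⟦_⟧    = ⟦_⟧
    ; +-homo = +-homo
    ; *-homo = *-homo
    ; -‿homo = -‿homo
    ; 0-homo = ≈-refl
    ; 1-homo = ≈-refl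
    }

  ⟦⟧-cong? : ∀ i j → Maybe (⟦ i ⟧ ≈ ⟦ j ⟧)
  ⟦⟧-cong? i j = Maybe.map (λ i≡j → ≈-reflexive (cong ⟦_⟧ i≡j)) (dec⇒maybe (i ℤₚ.≟ j))

  open RingSolver ℤ.+-*-rawRing (fromCommutativeRing R) morphism ⟦⟧-cong? public
    using (Polynomial; solve; con; _:+_; _:*_; :-_; _:-_; _:=_)

  :0 :1 : ∀ {n} → Polynomial n
  :0 = con (+ 0)
  :1 = con (+ 1)

-- Order and arithmetic in a complete ordered field

module OrderedField (em : ExcludedMiddle 0ℓ) (R : CompleteOrderedField) where

  open Analysis em R public
  open IsCommutativeRing isCommutativeRing public
    using (+-comm; +-assoc; +-identityˡ; +-identityʳ; *-comm; *-assoc;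
           *-identityˡ; *-identityʳ; distribˡ; distribʳ; zeroˡ; zeroʳ; -‿inverseʳ)
  open IsTotalOrder isTotalOrder public
    using (total; antisym; reflexive) renaming (refl to ≤-refl; trans to ≤-trans)

  commutativeRing : CommutativeRing 0ℓ 0ℓ
  commutativeRing = record { isCommutativeRing = isCommutativeRing }

  poset : Poset 0ℓ 0ℓ 0ℓ
  poset = record { isPartialOrder = IsTotalOrder.isPartialOrder isTotalOrder }

  open IntegerSolver commutativeRing public
  open import Relation.Binary.Reasoning.PartialOrder poset public hiding (stop)

  private module ℝ< = ToStrict _≡_ _≤_

  <⇒≤ : ∀ {x y} → x < y → x ≤ y
  <⇒≤ = proj₁

  <-irrefl : ∀ {x} → ¬ x < x
  <-irrefl (_ , x≢x) = x≢x refl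

  <-≤-trans : ∀ {x y z} → x < y → y ≤ z → x < z
  <-≤-trans = ℝ<.<-≤-trans sym ≤-trans antisym (λ { refl p → p })

  ≤-<-trans : ∀ {x y z} → x ≤ y → y < z → x < z
  ≤-<-trans = ℝ<.≤-<-trans ≤-trans antisym (λ { refl p → p })

  <-trans : ∀ {x y z} → x < y → y < z → x < z
  <-trans x<y y<z = <-≤-trans x<y (<⇒≤ y<z)

  ≰⇒> : ∀ {x y} → ¬ x ≤ y → y < x
  ≰⇒> = ℝ<.≰⇒> sym reflexive total

  <⇒≱ : ∀ {x y} → x < y → ¬ y ≤ x
  <⇒≱ (x≤y , x≢y) y≤x = x≢y (antisym x≤y y≤x)

  ≮⇒≥ : ∀ {x y} → ¬ x < y → y ≤ x
  ≮⇒≥ {x} {y} x≮y with em {y ≤ x}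
  ... | yes y≤x = y≤x
  ... | no  y≰x = ⊥-elim (x≮y (≰⇒> y≰x))

  ≤-or-> : ∀ x y → x ≤ y ⊎ y < x
  ≤-or-> x y with em {x ≤ y}
  ... | yes x≤y = inj₁ x≤y
  ... | no  x≰y = inj₂ (≰⇒> x≰y)

  +-monoʳ-≤ : ∀ z {x y} → x ≤ y → z + x ≤ z + y
  +-monoʳ-≤ z {x} {y} x≤y = subst₂ _≤_ (+-comm x z) (+-comm y z) (+-monoˡ-≤ z x≤y)

  +-mono-≤ : ∀ {x y u v} → x ≤ y → u ≤ v → x + u ≤ y + v
  +-mono-≤ {u = u} x≤y u≤v = ≤-trans (+-monoˡ-≤ u x≤y) (+-monoʳ-≤ _ u≤v)

  x+z-z≡x : ∀ x z → x + z - z ≡ x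
  x+z-z≡x = solve 2 (λ x z → x :+ z :- z := x) refl

  +-cancelʳ : ∀ z {x y} → x + z ≡ y + z → x ≡ y
  +-cancelʳ z {x} {y} eq = trans (sym (x+z-z≡x x z)) (trans (cong (_- z) eq) (x+z-z≡x y z))

  +-cancelʳ-≤ : ∀ z {x y} → x + z ≤ y + z → x ≤ y
  +-cancelʳ-≤ z {x} {y} le = subst₂ _≤_ (x+z-z≡x x z) (x+z-z≡x y z) (+-monoˡ-≤ (- z) le)

  +-monoˡ-< : ∀ z {x y} → x < y → x + z < y + z
  +-monoˡ-< z (x≤y , x≢y) = +-monoˡ-≤ z x≤y , λ eq → x≢y (+-cancelʳ z eq)

  +-monoʳ-< : ∀ z {x y} → x < y → z + x < z + y
  +-monoʳ-< z {x} {y} x<y = subst₂ _<_ (+-comm x z) (+-comm y z) (+-monoˡ-< z x<y)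

  +-mono-< : ∀ {x y u v} → x < y → u < v → x + u < y + v
  +-mono-< {u = u} x<y u<v = <-trans (+-monoˡ-< u x<y) (+-monoʳ-< _ u<v)

  x-y+y≡x : ∀ x y → x - y + y ≡ x
  x-y+y≡x = solve 2 (λ x y → x :- y :+ y := x) refl

  x≤y⇒0≤y-x : ∀ {x y} → x ≤ y → 0# ≤ y - x
  x≤y⇒0≤y-x {x} {y} x≤y = subst (_≤ y - x) (-‿inverseʳ x) (+-monoˡ-≤ (- x) x≤y)

  0≤y-x⇒x≤y : ∀ {x y} → 0# ≤ y - x → x ≤ y
  0≤y-x⇒x≤y {x} {y} p = subst₂ _≤_ (+-identityˡ x) (x-y+y≡x y x) (+-monoˡ-≤ x p)

  x<y⇒0<y-x : ∀ {x y} → x < y → 0# < y - x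
  x<y⇒0<y-x {x} {y} x<y = subst (_< y - x) (-‿inverseʳ x) (+-monoˡ-< (- x) x<y)

  x-y≡0⇒x≡y : ∀ {x y} → x - y ≡ 0# → x ≡ y
  x-y≡0⇒x≡y {x} {y} eq = trans (sym (x-y+y≡x x y)) (trans (cong (_+ y) eq) (+-identityˡ y))

  x≤y+z⇒x-y≤z : ∀ {x y z} → x ≤ y + z → x - y ≤ z
  x≤y+z⇒x-y≤z {x} {y} {z} le = subst (x - y ≤_)
    (solve 2 (λ y z → y :+ z :- y := z) refl y z) (+-monoˡ-≤ (- y) le)

  x-y≤z⇒x≤y+z : ∀ {x y z} → x - y ≤ z → x ≤ y + z
  x-y≤z⇒x≤y+z {x} {y} {z} le = subst₂ _≤_ (x-y+y≡x x y) (+-comm z y) (+-monoˡ-≤ y le)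

  neg-mono-≤ : ∀ {x y} → x ≤ y → - y ≤ - x
  neg-mono-≤ {x} {y} x≤y = 0≤y-x⇒x≤y (subst (0# ≤_)
    (solve 2 (λ x y → y :- x := :- x :- :- y) refl x y) (x≤y⇒0≤y-x x≤y))

  0≤x⇒-x≤0 : ∀ {x} → 0# ≤ x → - x ≤ 0#
  0≤x⇒-x≤0 0≤x = ≤-trans (neg-mono-≤ 0≤x) (reflexive (solve 0 (:- :0 := :0) refl))

  x≤0⇒0≤-x : ∀ {x} → x ≤ 0# → 0# ≤ - x
  x≤0⇒0≤-x x≤0 = ≤-trans (reflexive (solve 0 (:0 := :- :0) refl)) (neg-mono-≤ x≤0)

  *-monoʳ-≤ : ∀ {z} → 0# ≤ z → ∀ {x y} → x ≤ y → z * x ≤ z * y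
  *-monoʳ-≤ {z} 0≤z {x} {y} x≤y = 0≤y-x⇒x≤y (subst (0# ≤_)
    (solve 3 (λ x y z → z :* (y :- x) := z :* y :- z :* x) refl x y z)
    (*-nonNeg 0≤z (x≤y⇒0≤y-x x≤y)))

  *-monoˡ-≤ : ∀ {z} → 0# ≤ z → ∀ {x y} → x ≤ y → x * z ≤ y * z
  *-monoˡ-≤ {z} 0≤z {x} {y} x≤y = subst₂ _≤_ (*-comm z x) (*-comm z y) (*-monoʳ-≤ 0≤z x≤y)

  0≤x*x : ∀ x → 0# ≤ x * x
  0≤x*x x with total 0# x
  ... | inj₁ 0≤x = *-nonNeg 0≤x 0≤x
  ... | inj₂ x≤0 = subst (0# ≤_) (solve 1 (λ x → :- x :* :- x := x :* x) refl x)
                     (*-nonNeg (x≤0⇒0≤-x x≤0) (x≤0⇒0≤-x x≤0))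

  0<1 : 0# < 1#
  0<1 = subst (0# ≤_) (*-identityˡ 1#) (0≤x*x 1#) , 0≢1

  pos⇒≢0 : ∀ {x} → 0# < x → x ≢ 0#
  pos⇒≢0 (_ , 0≢x) x≡0 = 0≢x (sym x≡0)

  x*y≡0⇒y≡0 : ∀ {x y} → x ≢ 0# → x * y ≡ 0# → y ≡ 0#
  x*y≡0⇒y≡0 {x} {y} x≢0 xy≡0 = begin-equality
    y                 ≡⟨ *-identityˡ y ⟨
    1# * y            ≡⟨ cong (_* y) (⁻¹-inverseʳ x x≢0) ⟨
    x * x ⁻¹ * y      ≡⟨ solve 3 (λ x i y → x :* i :* y := i :* (x :* y)) refl x (x ⁻¹) y ⟩
    x ⁻¹ * (x * y)    ≡⟨ cong (x ⁻¹ *_) xy≡0 ⟩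
    x ⁻¹ * 0#         ≡⟨ zeroʳ _ ⟩
    0#                ∎

  *-pos : ∀ {x y} → 0# < x → 0# < y → 0# < x * y
  *-pos 0<x 0<y = *-nonNeg (<⇒≤ 0<x) (<⇒≤ 0<y) ,
    λ 0≡xy → proj₂ 0<y (sym (x*y≡0⇒y≡0 (pos⇒≢0 0<x) (sym 0≡xy)))

  *-monoˡ-< : ∀ {z} → 0# < z → ∀ {x y} → x < y → x * z < y * z
  *-monoˡ-< {z} 0<z {x} {y} (x≤y , x≢y) = *-monoˡ-≤ (<⇒≤ 0<z) x≤y , λ eq → x≢y (begin-equality
    x                 ≡⟨ *-identityʳ x ⟨
    x * 1#            ≡⟨ cong (x *_) z*z⁻¹ ⟨
    x * (z * z ⁻¹)    ≡⟨ *-assoc x z _ ⟨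
    x * z * z ⁻¹      ≡⟨ cong (_* z ⁻¹) eq ⟩
    y * z * z ⁻¹      ≡⟨ *-assoc y z _ ⟩
    y * (z * z ⁻¹)    ≡⟨ cong (y *_) z*z⁻¹ ⟩
    y * 1#            ≡⟨ *-identityʳ y ⟩
    y                 ∎)
    where z*z⁻¹ = ⁻¹-inverseʳ z (pos⇒≢0 0<z)

  *-cancelʳ-≤ : ∀ {z} → 0# < z → ∀ {x y} → x * z ≤ y * z → x ≤ y
  *-cancelʳ-≤ 0<z le = ≮⇒≥ λ y<x → <⇒≱ (*-monoˡ-< 0<z y<x) le

  ⁻¹-inverseˡ : ∀ {x} → x ≢ 0# → x ⁻¹ * x ≡ 1#
  ⁻¹-inverseˡ {x} x≢0 = trans (*-comm _ x) (⁻¹-inverseʳ x x≢0)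

  ⁻¹-unique : ∀ {x y} → x ≢ 0# → x * y ≡ 1# → y ≡ x ⁻¹
  ⁻¹-unique {x} {y} x≢0 xy≡1 = begin-equality
    y                 ≡⟨ *-identityˡ y ⟨
    1# * y            ≡⟨ cong (_* y) (⁻¹-inverseʳ x x≢0) ⟨
    x * x ⁻¹ * y      ≡⟨ solve 3 (λ x i y → x :* i :* y := i :* (x :* y)) refl x (x ⁻¹) y ⟩
    x ⁻¹ * (x * y)    ≡⟨ cong (x ⁻¹ *_) xy≡1 ⟩
    x ⁻¹ * 1#         ≡⟨ *-identityʳ _ ⟩
    x ⁻¹              ∎

  ⁻¹-pos : ∀ {x} → 0# < x → 0# < x ⁻¹
  ⁻¹-pos {x} 0<x = ≰⇒> λ x⁻¹≤0 → <⇒≱ 0<1 (begin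
    1#          ≡⟨ ⁻¹-inverseʳ x (pos⇒≢0 0<x) ⟨
    x * x ⁻¹    ≤⟨ *-monoʳ-≤ (<⇒≤ 0<x) x⁻¹≤0 ⟩
    x * 0#      ≡⟨ zeroʳ x ⟩
    0#          ∎)

  x/y*y≡x : ∀ x {y} → 0# < y → x / y * y ≡ x
  x/y*y≡x x {y} 0<y = trans (*-assoc x _ y) (trans (cong (x *_) (⁻¹-inverseˡ (pos⇒≢0 0<y))) (*-identityʳ x))

  x≤y*z⇒x/z≤y : ∀ {x y z} → 0# < z → x ≤ y * z → x / z ≤ y
  x≤y*z⇒x/z≤y 0<z le = *-cancelʳ-≤ 0<z (subst (_≤ _) (sym (x/y*y≡x _ 0<z)) le)

  y*z≤x⇒y≤x/z : ∀ {x y z} → 0# < z → y * z ≤ x → y ≤ x / z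
  y*z≤x⇒y≤x/z 0<z le = *-cancelʳ-≤ 0<z (subst (_ ≤_) (sym (x/y*y≡x _ 0<z)) le)

  /-pos : ∀ {x y} → 0# < x → 0# < y → 0# < x / y
  /-pos 0<x 0<y = *-pos 0<x (⁻¹-pos 0<y)

  ⁻¹-anti-≤ : ∀ {x y} → 0# < x → x ≤ y → y ⁻¹ ≤ x ⁻¹
  ⁻¹-anti-≤ {x} {y} 0<x x≤y = *-cancelʳ-≤ 0<y (begin
    y ⁻¹ * y    ≡⟨ ⁻¹-inverseˡ (pos⇒≢0 0<y) ⟩
    1#          ≡⟨ ⁻¹-inverseˡ (pos⇒≢0 0<x) ⟨
    x ⁻¹ * x    ≤⟨ *-monoʳ-≤ (<⇒≤ (⁻¹-pos 0<x)) x≤y ⟩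
    x ⁻¹ * y    ∎)
    where 0<y = <-≤-trans 0<x x≤y

  1⁻¹≡1 : 1# ⁻¹ ≡ 1#
  1⁻¹≡1 = sym (⁻¹-unique (pos⇒≢0 0<1) (*-identityˡ 1#))

  ⁻¹-*-distrib : ∀ {x y} → 0# < x → 0# < y → (x * y) ⁻¹ ≡ x ⁻¹ * y ⁻¹
  ⁻¹-*-distrib {x} {y} 0<x 0<y = sym (⁻¹-unique (pos⇒≢0 (*-pos 0<x 0<y)) (begin-equality
    x * y * (x ⁻¹ * y ⁻¹)      ≡⟨ solve 4 (λ x y i j → x :* y :* (i :* j) := (x :* i) :* (y :* j)) refl x y (x ⁻¹) (y ⁻¹) ⟩
    (x * x ⁻¹) * (y * y ⁻¹)    ≡⟨ cong₂ _*_ (⁻¹-inverseʳ x (pos⇒≢0 0<x)) (⁻¹-inverseʳ y (pos⇒≢0 0<y)) ⟩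
    1# * 1#                    ≡⟨ *-identityˡ 1# ⟩
    1#                         ∎))

  x/y/z≡x/[y*z] : ∀ x {y z} → 0# < y → 0# < z → x / y / z ≡ x / (y * z)
  x/y/z≡x/[y*z] x {y} {z} 0<y 0<z =
    trans (*-assoc x _ _) (cong (x *_) (sym (⁻¹-*-distrib 0<y 0<z)))

  x/1≡x : ∀ x → x / 1# ≡ x
  x/1≡x x = trans (cong (x *_) 1⁻¹≡1) (*-identityʳ x)

  -- The natural numbers in ℝ

  fromℕ-+ : ∀ m n → fromℕ (m ℕ.+ n) ≡ fromℕ m + fromℕ n
  fromℕ-+ zero    n = sym (+-identityˡ _)
  fromℕ-+ (suc m) n = trans (cong (_+ 1#) (fromℕ-+ m n))
    (solve 3 (λ x y z → x :+ y :+ z := x :+ z :+ y) refl (fromℕ m) (fromℕ n) 1#)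

  fromℕ-* : ∀ m n → fromℕ (m ℕ.* n) ≡ fromℕ m * fromℕ n
  fromℕ-* zero    n = sym (zeroˡ _)
  fromℕ-* (suc m) n = begin-equality
    fromℕ (n ℕ.+ m ℕ.* n)            ≡⟨ fromℕ-+ n (m ℕ.* n) ⟩
    fromℕ n + fromℕ (m ℕ.* n)        ≡⟨ cong (fromℕ n +_) (fromℕ-* m n) ⟩
    fromℕ n + fromℕ m * fromℕ n      ≡⟨ solve 2 (λ x y → y :+ x :* y := (x :+ :1) :* y) refl (fromℕ m) (fromℕ n) ⟩
    (fromℕ m + 1#) * fromℕ n         ∎

  fromℕ-1 : fromℕ 1 ≡ 1#
  fromℕ-1 = +-identityˡ 1#

  2≡1+1 : 2# ≡ 1# + 1#
  2≡1+1 = cong (_+ 1#) fromℕ-1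

  x<x+1 : ∀ x → x < x + 1#
  x<x+1 x = subst (_< x + 1#) (+-identityʳ x) (+-monoʳ-< x 0<1)

  0≤fromℕ : ∀ n → 0# ≤ fromℕ n
  0≤fromℕ zero    = ≤-refl
  0≤fromℕ (suc n) = ≤-trans (0≤fromℕ n) (<⇒≤ (x<x+1 _))

  fromℕ-mono-≤ : ∀ {m n} → m ℕ.≤ n → fromℕ m ≤ fromℕ n
  fromℕ-mono-≤ {n = n} z≤n = 0≤fromℕ n
  fromℕ-mono-≤ (s≤s m≤n)   = +-monoˡ-≤ 1# (fromℕ-mono-≤ m≤n)

  1≤fromℕ : ∀ {n} → 1 ℕ.≤ n → 1# ≤ fromℕ n
  1≤fromℕ {n} 1≤n = subst (_≤ fromℕ n) fromℕ-1 (fromℕ-mono-≤ 1≤n)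

  fromℕ-pos : ∀ {n} → 1 ℕ.≤ n → 0# < fromℕ n
  fromℕ-pos 1≤n = <-≤-trans 0<1 (1≤fromℕ 1≤n)

  fromℕ-cancel-< : ∀ {m n} → fromℕ m < fromℕ n → m ℕ.< n
  fromℕ-cancel-< m<n = ℕₚ.≰⇒> λ n≤m → <⇒≱ m<n (fromℕ-mono-≤ n≤m)

  1<2 : 1# < 2#
  1<2 = subst (1# <_) (sym 2≡1+1) (x<x+1 1#)

  0<2 : 0# < 2#
  0<2 = <-trans 0<1 1<2

  halves : ∀ x → x ≡ x / 2# + x / 2#
  halves x = trans (sym (x/y*y≡x x 0<2)) (trans (cong (x / 2# *_) 2≡1+1)
    (solve 1 (λ h → h :* (:1 :+ :1) := h :+ h) refl (x / 2#)))

  -- If the naturals were bounded they would have a supremum `s`; as n + 1 ≤ s for every n, `s - 1#`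
  -- would be a smaller upper bound.
  archimedean : ∀ x → ∃ λ n → x < fromℕ n
  archimedean x with em {∃ λ n → x < fromℕ n}
  ... | yes p = p
  ... | no ¬p with complete (λ y → ∃ λ n → y ≡ fromℕ n) (0# , 0 , refl)
                   (x , λ { _ (n , refl) → ≮⇒≥ λ x<n → ¬p (n , x<n) })
  ...   | s , ub , least = ⊥-elim (<⇒≱ (x<x+1 s) (≤-trans (+-monoˡ-≤ 1# s≤s-1) (reflexive (x-y+y≡x s 1#))))
    where
    s≤s-1 : s ≤ s - 1#
    s≤s-1 = least (s - 1#) λ { _ (n , refl) →
      subst (_≤ s - 1#) (x+z-z≡x _ 1#) (+-monoˡ-≤ (- 1#) (ub _ (suc n , refl))) }

-- Logarithm, exponential and real powers from the Darboux integral

module Logarithm (em : ExcludedMiddle 0ℓ) (R : CompleteOrderedField) where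

  open OrderedField em R public

  -- The real chosen by `the` may differ from the given witness, so only the property carries over;
  -- identifying the value takes a separate uniqueness argument.
  the-satisfies : ∀ {P : ℝ → Set} → ∃ P → P (the P)
  the-satisfies {P} ∃P with em {∃ P}
  ... | yes (_ , Px) = Px
  ... | no  ∄P       = ⊥-elim (∄P ∃P)

  n≤2^n : ∀ n → n ℕ.≤ 2 ℕ.^ n
  n≤2^n zero    = z≤n
  n≤2^n (suc n) = ℕₚ.+-mono-≤ (ℕₚ.m^n>0 2 n) (ℕₚ.≤-trans (n≤2^n n) (ℕₚ.m≤m+n _ 0))

  -- The Archimedean property in the shape that bisection produces: a quantity that stays bounded
  -- after k doublings, for every k, cannot be positive.
  *2^-bounded⇒≤0 : ∀ {x C} → (∀ k → x * fromℕ (2 ℕ.^ k) ≤ C) → x ≤ 0#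
  *2^-bounded⇒≤0 {x} {C} bound = ≮⇒≥ λ 0<x →
    let n , C/x<n = archimedean (C / x) in
    <⇒≱ C/x<n (y*z≤x⇒y≤x/z 0<x (begin
      fromℕ n * x            ≡⟨ *-comm _ x ⟩
      x * fromℕ n            ≤⟨ *-monoʳ-≤ (<⇒≤ 0<x) (fromℕ-mono-≤ (n≤2^n n)) ⟩
      x * fromℕ (2 ℕ.^ n)    ≤⟨ bound n ⟩
      C                      ∎))

  -- Step sums and the Darboux integral

  module _ {_≲_ : Rel ℝ 0ℓ} {f : ℝ → ℝ} where

    single : ∀ {a b c} → a ≤ b → (∀ u → a ≤ u → u ≤ b → c ≲ f u) → StepSum _≲_ f a b (c * (b - a))
    single a≤b c≲f = subst (StepSum _≲_ f _ _) (+-identityʳ _) (step a≤b c≲f stop)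

    append : ∀ {a b c σ τ} → StepSum _≲_ f a b σ → StepSum _≲_ f b c τ → StepSum _≲_ f a c (σ + τ)
    append stop              T = subst (StepSum _≲_ f _ _) (sym (+-identityˡ _)) T
    append (step a≤t c≲f S)  T = subst (StepSum _≲_ f _ _) (sym (+-assoc _ _ _)) (step a≤t c≲f (append S T))

    StepSum⇒≤ : ∀ {a b σ} → StepSum _≲_ f a b σ → a ≤ b
    StepSum⇒≤ stop           = ≤-refl
    StepSum⇒≤ (step a≤t _ S) = ≤-trans a≤t (StepSum⇒≤ S)

    -- The step containing `b` is cut there into two steps of the same height, which leaves the
    -- total area unchanged.
    split : ∀ {a b c σ} → a ≤ b → b ≤ c → StepSum _≲_ f a c σ →
            ∃ λ σ₁ → ∃ λ σ₂ → StepSum _≲_ f a b σ₁ × StepSum _≲_ f b c σ₂ × σ ≡ σ₁ + σ₂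
    split {a} a≤b b≤a stop with antisym a≤b b≤a
    ... | refl = 0# , 0# , stop , stop , sym (+-identityˡ 0#)
    split {a} {b} a≤b b≤c (step {t = t} {c = k} {σ = σ} a≤t k≲f S) with total b t
    ... | inj₁ b≤t = _ , _ , single a≤b (λ u a≤u u≤b → k≲f u a≤u (≤-trans u≤b b≤t)) ,
                     step b≤t (λ u b≤u → k≲f u (≤-trans a≤b b≤u)) S ,
                     solve 5 (λ k t a b σ → k :* (t :- a) :+ σ := k :* (b :- a) :+ (k :* (t :- b) :+ σ))
                       refl k t a b σ
    ... | inj₂ t≤b with split t≤b b≤c S
    ...   | σ₁ , σ₂ , S₁ , S₂ , refl = _ , σ₂ , step a≤t k≲f S₁ , S₂ , sym (+-assoc _ σ₁ σ₂)

  module _ {f : ℝ → ℝ} where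

    lower≤const : ∀ {a b C σ} → (∀ u → a ≤ u → u ≤ b → f u ≤ C) → StepSum _≤_ f a b σ → σ ≤ C * (b - a)
    lower≤const {a} {C = C} f≤C stop = reflexive (solve 2 (λ C a → :0 := C :* (a :- a)) refl C a)
    lower≤const {a} {b} {C} f≤C (step {t = t} {c = c} {σ = σ} a≤t c≤f S) = begin
      c * (t - a) + σ              ≤⟨ +-mono-≤ (*-monoˡ-≤ (x≤y⇒0≤y-x a≤t)
                                        (≤-trans (c≤f a ≤-refl a≤t) (f≤C a ≤-refl (≤-trans a≤t (StepSum⇒≤ S)))))
                                        (lower≤const (λ u t≤u → f≤C u (≤-trans a≤t t≤u)) S) ⟩
      C * (t - a) + C * (b - t)    ≡⟨ solve 4 (λ C t a b → C :* (t :- a) :+ C :* (b :- t) := C :* (b :- a)) refl C t a b ⟩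
      C * (b - a)                  ∎

    -- In place of a common refinement, the lower sum is cut at each breakpoint of the upper sum; on
    -- each piece the upper step is a constant bound for `f`.
    lower≤upper : ∀ {a b σ τ} → StepSum _≤_ f a b σ → StepSum (flip _≤_) f a b τ → σ ≤ τ
    -- `S` may still contain steps of length zero, so it is bounded by the constant `f a` on a
    -- degenerate interval.
    lower≤upper {a} S stop = subst (_ ≤_) (solve 2 (λ C a → C :* (a :- a) := :0) refl (f a) a)
      (lower≤const (λ u a≤u u≤a → reflexive (cong f (antisym u≤a a≤u))) S)
    lower≤upper S (step a≤t f≤c T) with split a≤t (StepSum⇒≤ T) S
    ... | σ₁ , σ₂ , S₁ , S₂ , refl = +-mono-≤ (lower≤const f≤c S₁) (lower≤upper S₂ T)

  -- The integral of 1/t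

  private
    Lower Upper : ℝ → ℝ → ℝ → Set
    Lower = StepSum _≤_ _⁻¹
    Upper = StepSum (flip _≤_) _⁻¹

    -- Each bisection halves the bound (1/a − 1/b) (b − a) on the gap.
    lower-upper-gap : ∀ k {a b} → 0# < a → a ≤ b → ∃ λ l → ∃ λ u → Lower a b l × Upper a b u ×
                      (u - l) * fromℕ (2 ℕ.^ k) ≤ (a ⁻¹ - b ⁻¹) * (b - a)
    lower-upper-gap zero {a} {b} 0<a a≤b =
      _ , _ , single a≤b (λ u a≤u u≤b → ⁻¹-anti-≤ (<-≤-trans 0<a a≤u) u≤b) ,
      single a≤b (λ u a≤u u≤b → ⁻¹-anti-≤ 0<a a≤u) , reflexive
        (trans (cong ((a ⁻¹ * (b - a) - b ⁻¹ * (b - a)) *_) fromℕ-1)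
          (solve 4 (λ i j a b → (i :* (b :- a) :- j :* (b :- a)) :* :1 := (i :- j) :* (b :- a)) refl (a ⁻¹) (b ⁻¹) a b))
    lower-upper-gap (suc k) {a} {b} 0<a a≤b =
      l₁ + l₂ , u₁ + u₂ , append L₁ L₂ , append U₁ U₂ , (begin
        (u₁ + u₂ - (l₁ + l₂)) * fromℕ (2 ℕ.* 2 ℕ.^ k)
          ≡⟨ cong ((u₁ + u₂ - (l₁ + l₂)) *_) (trans (fromℕ-* 2 (2 ℕ.^ k)) (cong (_* N) 2≡1+1)) ⟩
        (u₁ + u₂ - (l₁ + l₂)) * ((1# + 1#) * N)
          ≡⟨ solve 5 (λ u₁ u₂ l₁ l₂ N → (u₁ :+ u₂ :- (l₁ :+ l₂)) :* ((:1 :+ :1) :* N) :=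
               ((u₁ :- l₁) :* N :+ (u₂ :- l₂) :* N) :+ ((u₁ :- l₁) :* N :+ (u₂ :- l₂) :* N)) refl u₁ u₂ l₁ l₂ N ⟩
        ((u₁ - l₁) * N + (u₂ - l₂) * N) + ((u₁ - l₁) * N + (u₂ - l₂) * N)
          ≤⟨ +-mono-≤ (+-mono-≤ gap₁ gap₂) (+-mono-≤ gap₁ gap₂) ⟩
        ((a ⁻¹ - m ⁻¹) * (m - a) + (m ⁻¹ - b ⁻¹) * (b - m)) + ((a ⁻¹ - m ⁻¹) * (m - a) + (m ⁻¹ - b ⁻¹) * (b - m))
          ≡⟨ cong (λ z → ((a ⁻¹ - m ⁻¹) * (m - a) + (m ⁻¹ - b ⁻¹) * z) + ((a ⁻¹ - m ⁻¹) * (m - a) + (m ⁻¹ - b ⁻¹) * z)) b-m≡h ⟩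
        ((a ⁻¹ - m ⁻¹) * (m - a) + (m ⁻¹ - b ⁻¹) * h) + ((a ⁻¹ - m ⁻¹) * (m - a) + (m ⁻¹ - b ⁻¹) * h)
          -- Both halves have length `h`, so the differences 1/a - 1/m and 1/m - 1/b telescope; the
          -- doubling from 2^(k+1) restores h + h = b - a.
          ≡⟨ solve 5 (λ i j p a h → ((i :- p) :* (a :+ h :- a) :+ (p :- j) :* h) :+ ((i :- p) :* (a :+ h :- a) :+ (p :- j) :* h)
               := (i :- j) :* (h :+ h)) refl (a ⁻¹) (b ⁻¹) (m ⁻¹) a h ⟩
        (a ⁻¹ - b ⁻¹) * (h + h)
          ≡⟨ cong ((a ⁻¹ - b ⁻¹) *_) (halves (b - a)) ⟨
        (a ⁻¹ - b ⁻¹) * (b - a)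
          ∎)
      where
      N h m : ℝ
      N = fromℕ (2 ℕ.^ k)
      h = (b - a) / 2#
      m = a + h
      b-m≡h : b - m ≡ h
      b-m≡h = trans (solve 3 (λ a b h → b :- (a :+ h) := (b :- a) :- h) refl a b h)
                (trans (cong (_- h) (halves (b - a))) (x+z-z≡x h h))
      0≤h : 0# ≤ h
      0≤h = *-nonNeg (x≤y⇒0≤y-x a≤b) (<⇒≤ (⁻¹-pos 0<2))
      a≤m : a ≤ m
      a≤m = subst (_≤ m) (+-identityʳ a) (+-monoʳ-≤ a 0≤h)
      m≤b : m ≤ b
      m≤b = 0≤y-x⇒x≤y (subst (0# ≤_) (sym b-m≡h) 0≤h)
      first = lower-upper-gap k 0<a a≤m
      second = lower-upper-gap k (<-≤-trans 0<a a≤m) m≤b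
      l₁ = proj₁ first
      u₁ = proj₁ (proj₂ first)
      l₂ = proj₁ second
      u₂ = proj₁ (proj₂ second)
      L₁ = proj₁ (proj₂ (proj₂ first))
      U₁ = proj₁ (proj₂ (proj₂ (proj₂ first)))
      gap₁ = proj₂ (proj₂ (proj₂ (proj₂ first)))
      L₂ = proj₁ (proj₂ (proj₂ second))
      U₂ = proj₁ (proj₂ (proj₂ (proj₂ second)))
      gap₂ = proj₂ (proj₂ (proj₂ (proj₂ second)))

    J : ℝ → ℝ → ℝ
    J a b = ∫ a b _⁻¹

    -- If `v` is below all upper sums, then v - I ≤ u - l for every upper `u` and lower `l`.
    -- Bisection makes u - l at most a fixed constant over 2^k, which forces v ≤ I.
    lower-sup⇒integral : ∀ {a b I} → 0# < a → a ≤ b → IsSup _≤_ (Lower a b) I → IsIntegral _⁻¹ a b I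
    lower-sup⇒integral {a} {b} {I} 0<a a≤b (l≤I , I-least) =
      (l≤I , I-least) , (λ u U → I-least u λ l L → lower≤upper L U) , I-greatest
      where
      I-greatest : ∀ v → (∀ u → Upper a b u → v ≤ u) → v ≤ I
      I-greatest v v≤u = subst (v ≤_) (+-identityʳ I) (x-y≤z⇒x≤y+z (*2^-bounded⇒≤0 {C = (a ⁻¹ - b ⁻¹) * (b - a)} λ k →
        let l , u , L , U , gap = lower-upper-gap k 0<a a≤b in
        ≤-trans (*-monoˡ-≤ (0≤fromℕ (2 ℕ.^ k)) (+-mono-≤ (v≤u u U) (neg-mono-≤ (l≤I l L)))) gap))

    J-isIntegral : ∀ {a b} → 0# < a → a ≤ b → IsIntegral _⁻¹ a b (J a b)
    J-isIntegral {a} {b} 0<a a≤b = the-satisfies {IsIntegral _⁻¹ a b} (I , lower-sup⇒integral 0<a a≤b I-sup)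
      where
      bounds = lower-upper-gap 0 0<a a≤b
      sup : ∃ (IsSup _≤_ (Lower a b))
      sup = complete (Lower a b) (proj₁ bounds , proj₁ (proj₂ (proj₂ bounds)))
        (proj₁ (proj₂ bounds) , λ l L → lower≤upper L (proj₁ (proj₂ (proj₂ (proj₂ bounds)))))
      I = proj₁ sup
      I-sup = proj₂ sup

    lower≤J : ∀ {a b l} → 0# < a → Lower a b l → l ≤ J a b
    lower≤J 0<a L = proj₁ (proj₁ (J-isIntegral 0<a (StepSum⇒≤ L))) _ L

    J≤upper : ∀ {a b u} → 0# < a → Upper a b u → J a b ≤ u
    J≤upper 0<a U = proj₁ (proj₂ (J-isIntegral 0<a (StepSum⇒≤ U))) _ U

    -- Since 1/t is integrable, lying between all lower and all upper sums pins a number down;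
    -- additivity and scaling are both proved this way.
    J-unique : ∀ {a b I} → 0# < a → a ≤ b → (∀ l → Lower a b l → l ≤ I) → (∀ u → Upper a b u → I ≤ u) → J a b ≡ I
    J-unique {I = I} 0<a a≤b l≤I I≤u =
      antisym (proj₂ (proj₁ (J-isIntegral 0<a a≤b)) I l≤I) (proj₂ (proj₂ (J-isIntegral 0<a a≤b)) I I≤u)

    J-additive : ∀ {a b c} → 0# < a → a ≤ b → b ≤ c → J a c ≡ J a b + J b c
    J-additive {a} {b} {c} 0<a a≤b b≤c = J-unique 0<a (≤-trans a≤b b≤c) below above
      where
      0<b = <-≤-trans 0<a a≤b
      below : ∀ l → Lower a c l → l ≤ J a b + J b c
      below l L with split a≤b b≤c L
      ... | _ , _ , L₁ , L₂ , refl = +-mono-≤ (lower≤J 0<a L₁) (lower≤J 0<b L₂)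
      above : ∀ u → Upper a c u → J a b + J b c ≤ u
      above u U with split a≤b b≤c U
      ... | _ , _ , U₁ , U₂ , refl = +-mono-≤ (J≤upper 0<a U₁) (J≤upper 0<b U₂)

    -- Dilation by `s` stretches each step by `s` and divides its height by `s`, as 1/t demands, so
    -- areas are preserved. The relation is left abstract to serve lower and upper sums alike.
    scale : ∀ {_≲_ : Rel ℝ 0ℓ} {s} → 0# < s → (∀ {x y} → x ≲ y → (x * s ⁻¹) ≲ (y * s ⁻¹)) →
            ∀ {a b σ} → 0# < a → StepSum _≲_ _⁻¹ a b σ → StepSum _≲_ _⁻¹ (s * a) (s * b) σ
    scale 0<s *-mono 0<a stop = stop
    scale {_≲_} {s} 0<s *-mono {a} 0<a (step {t = t} {c = c} {σ = σ} a≤t c≲ S) =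
      subst (StepSum _≲_ _⁻¹ _ _) eq
        (step (*-monoʳ-≤ (<⇒≤ 0<s) a≤t) c≲′ (scale 0<s *-mono (<-≤-trans 0<a a≤t) S))
      where
      eq : c * s ⁻¹ * (s * t - s * a) + σ ≡ c * (t - a) + σ
      eq = trans (solve 6 (λ c i s t a σ → c :* i :* (s :* t :- s :* a) :+ σ := (s :* i) :* (c :* (t :- a)) :+ σ)
                    refl c (s ⁻¹) s t a σ)
             (cong (_+ σ) (trans (cong (_* (c * (t - a))) (⁻¹-inverseʳ s (pos⇒≢0 0<s))) (*-identityˡ _)))
      c≲′ : ∀ v → s * a ≤ v → v ≤ s * t → (c * s ⁻¹) ≲ (v ⁻¹)
      c≲′ v sa≤v v≤st = subst ((c * s ⁻¹) ≲_)
        (trans (sym (⁻¹-*-distrib (<-≤-trans 0<a a≤u) 0<s)) (cong _⁻¹ (x/y*y≡x v 0<s)))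
        (*-mono (c≲ (v / s) a≤u (x≤y*z⇒x/z≤y 0<s (subst (v ≤_) (*-comm s t) v≤st))))
        where
        a≤u : a ≤ v / s
        a≤u = y*z≤x⇒y≤x/z 0<s (subst (_≤ v) (*-comm s a) sa≤v)

    J-scale : ∀ {s a b} → 0# < s → 0# < a → a ≤ b → J (s * a) (s * b) ≡ J a b
    J-scale {s} 0<s 0<a a≤b = sym (J-unique 0<a a≤b
      (λ l L → lower≤J (*-pos 0<s 0<a) (scale 0<s (*-monoˡ-≤ 0≤s⁻¹) 0<a L))
      (λ u U → J≤upper (*-pos 0<s 0<a) (scale 0<s (*-monoˡ-≤ 0≤s⁻¹) 0<a U)))
      where 0≤s⁻¹ = <⇒≤ (⁻¹-pos 0<s)

  -- Removes the case distinction at 1 from the definition of `log`: wherever `x` and `y` lie, the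
  -- increment of `log` is one integral of 1/t.
  log-difference : ∀ {x y} → 0# < x → x ≤ y → log y ≡ log x + J x y
  log-difference {x} {y} 0<x x≤y with em {1# ≤ x} | em {1# ≤ y}
  ... | yes 1≤x | yes _   = J-additive 0<1 1≤x x≤y
  ... | yes 1≤x | no  1≰y = ⊥-elim (1≰y (≤-trans 1≤x x≤y))
  ... | no  1≰x | yes 1≤y = trans (solve 2 (λ p q → q := :- p :+ (p :+ q)) refl (J x 1#) (J 1# y))
                              (cong (- J x 1# +_) (sym (J-additive 0<x (<⇒≤ (≰⇒> 1≰x)) 1≤y)))
  ... | no  1≰x | no  1≰y = trans (solve 2 (λ p q → :- q := :- (p :+ q) :+ p) refl (J x y) (J y 1#))
                              (cong (λ z → - z + J x y) (sym (J-additive 0<x x≤y (<⇒≤ (≰⇒> 1≰y)))))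

  -- A single step of height `x ⁻¹` dominates 1/t on the interval. The resulting control on the
  -- growth of `log` is what makes the supremum argument in `log-sup` work.
  log-upper : ∀ {x y} → 0# < x → x ≤ y → log y ≤ log x + x ⁻¹ * (y - x)
  log-upper {x} {y} 0<x x≤y = subst (_≤ log x + x ⁻¹ * (y - x)) (sym (log-difference 0<x x≤y))
    (+-monoʳ-≤ (log x) (J≤upper 0<x (single x≤y λ u x≤u _ → ⁻¹-anti-≤ 0<x x≤u)))

  log-lower : ∀ {x y} → 0# < x → x ≤ y → log x + y ⁻¹ * (y - x) ≤ log y
  log-lower {x} {y} 0<x x≤y = subst (log x + y ⁻¹ * (y - x) ≤_) (sym (log-difference 0<x x≤y))
    (+-monoʳ-≤ (log x) (lower≤J 0<x (single x≤y λ u x≤u u≤y → ⁻¹-anti-≤ (<-≤-trans 0<x x≤u) u≤y)))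

  log-mono-< : ∀ {x y} → 0# < x → x < y → log x < log y
  log-mono-< {x} {y} 0<x x<y = <-≤-trans
    (subst (_< log x + y ⁻¹ * (y - x)) (+-identityʳ (log x))
      (+-monoʳ-< (log x) (*-pos (⁻¹-pos (<-trans 0<x x<y)) (x<y⇒0<y-x x<y))))
    (log-lower 0<x (<⇒≤ x<y))

  log-cancel-≤ : ∀ {x y} → 0# < y → log x ≤ log y → x ≤ y
  log-cancel-≤ 0<y le = ≮⇒≥ λ y<x → <⇒≱ (log-mono-< 0<y y<x) le

  log-mono-≤ : ∀ {x y} → 0# < x → x ≤ y → log x ≤ log y
  log-mono-≤ {x} 0<x x≤y with em {x ≡ _}
  ... | yes x≡y = reflexive (cong log x≡y)
  ... | no  x≢y = <⇒≤ (log-mono-< 0<x (x≤y , x≢y))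

  log-injective : ∀ {x y} → 0# < x → 0# < y → log x ≡ log y → x ≡ y
  log-injective 0<x 0<y eq = antisym (log-cancel-≤ 0<y (reflexive eq)) (log-cancel-≤ 0<x (reflexive (sym eq)))

  log-1 : log 1# ≡ 0#
  log-1 = trans (log-difference 0<1 ≤-refl) (trans (cong (log 1# +_) J≡-log) (-‿inverseʳ _))
    where
    J≡-log : J 1# 1# ≡ - log 1#
    J≡-log with em {1# ≤ 1#}
    ... | no 1≰1 = ⊥-elim (1≰1 ≤-refl)
    ... | yes _  = trans J≡0 (trans (solve 0 (:0 := :- :0) refl) (cong -_ (sym J≡0)))
      where
      J≡0 : J 1# 1# ≡ 0#
      J≡0 = trans (solve 1 (λ j → j := (j :+ j) :- j) refl (J 1# 1#))
        (trans (cong (_- J 1# 1#) (sym (J-additive 0<1 ≤-refl ≤-refl))) (-‿inverseʳ _))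

  -- Dilation by `x` carries the integral between 1 and `y` to the one between `x` and `x * y`; the
  -- cases are the two orders of 1 and `y`.
  log-* : ∀ {x y} → 0# < x → 0# < y → log (x * y) ≡ log x + log y
  log-* {x} {y} 0<x 0<y with total 1# y
  ... | inj₁ 1≤y = begin-equality
    log (x * y)                     ≡⟨ log-difference 0<x1 (*-monoʳ-≤ (<⇒≤ 0<x) 1≤y) ⟩
    log (x * 1#) + J (x * 1#) (x * y) ≡⟨ cong₂ _+_ (cong log (*-identityʳ x)) (J-scale 0<x 0<1 1≤y) ⟩
    log x + J 1# y                  ≡⟨ cong (log x +_) (trans (log-difference 0<1 1≤y) (trans (cong (_+ J 1# y) log-1) (+-identityˡ _))) ⟨
    log x + log y                   ∎
    where 0<x1 = subst (0# <_) (sym (*-identityʳ x)) 0<x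
  ... | inj₂ y≤1 = begin-equality
    log (x * y)                     ≡⟨ x+z-z≡x _ (J y 1#) ⟨
    log (x * y) + J y 1# - J y 1#   ≡⟨ cong (_- J y 1#) logx ⟨
    log x - J y 1#                  ≡⟨ cong (log x +_) logy ⟩
    log x + log y                   ∎
    where
    logx : log x ≡ log (x * y) + J y 1#
    logx = begin-equality
      log x                              ≡⟨ cong log (*-identityʳ x) ⟨
      log (x * 1#)                       ≡⟨ log-difference (*-pos 0<x 0<y) (*-monoʳ-≤ (<⇒≤ 0<x) y≤1) ⟩
      log (x * y) + J (x * y) (x * 1#)   ≡⟨ cong (log (x * y) +_) (J-scale 0<x 0<y y≤1) ⟩
      log (x * y) + J y 1#               ∎
    logy : - J y 1# ≡ log y
    logy = trans (sym (+-identityˡ _)) (trans (cong (_- J y 1#) (trans (sym log-1) (log-difference 0<y y≤1))) (x+z-z≡x _ _))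

  -- One step of height 1/2 on [1, 2] gives log 2 ≥ 1/2. Each factor 4 thus raises the logarithm by
  -- at least 1, which makes it unbounded.
  1≤log2+log2 : 1# ≤ log 2# + log 2#
  1≤log2+log2 = subst (_≤ log 2# + log 2#) (sym (halves 1#)) (+-mono-≤ half half)
    where
    half : 1# / 2# ≤ log 2#
    half = begin
      1# / 2#                         ≡⟨ *-comm 1# _ ⟩
      2# ⁻¹ * 1#                      ≡⟨ cong (2# ⁻¹ *_) (trans (cong (_- 1#) 2≡1+1) (x+z-z≡x 1# 1#)) ⟨
      2# ⁻¹ * (2# - 1#)               ≡⟨ trans (cong (_+ 2# ⁻¹ * (2# - 1#)) log-1) (+-identityˡ _) ⟨
      log 1# + 2# ⁻¹ * (2# - 1#)      ≤⟨ log-lower 0<1 (<⇒≤ 1<2) ⟩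
      log 2#                          ∎

  log-unbounded : ∀ n → ∃ λ x → 0# < x × fromℕ n ≤ log x
  log-unbounded zero    = 1# , 0<1 , reflexive (sym log-1)
  log-unbounded (suc n) =
    let x , 0<x , n≤logx = log-unbounded n in
    x * (2# * 2#) , *-pos 0<x (*-pos 0<2 0<2) , (begin
    fromℕ n + 1#                ≤⟨ +-mono-≤ n≤logx 1≤log2+log2 ⟩
    log x + (log 2# + log 2#)   ≡⟨ cong (log x +_) (log-* 0<2 0<2) ⟨
    log x + log (2# * 2#)       ≡⟨ log-* 0<x (*-pos 0<2 0<2) ⟨
    log (x * (2# * 2#))         ∎)

  -- The supremum s of the x with log x ≤ y works: if log s misses y by δ, then s (1 + δ),
  -- respectively s / (1 + δ), is still on the same side of y.
  log-sup : ∀ {y s} → 0# ≤ y → IsSup _≤_ (λ x → 0# < x × log x ≤ y) s → 0# < s × log s ≡ y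
  log-sup {y} {s} 0≤y (ub , least) = 0<s , antisym (≮⇒≥ not-above) (≮⇒≥ not-below)
    where
    0<s : 0# < s
    0<s = <-≤-trans 0<1 (ub 1# (0<1 , subst (_≤ y) (sym log-1) 0≤y))
    grow : ∀ {t δ} → 0# < t → 0# < δ → t < t * (1# + δ) × log (t * (1# + δ)) ≤ log t + δ
    grow {t} {δ} 0<t 0<δ = t<t′ , subst (log (t * (1# + δ)) ≤_) (cong (log t +_) (begin-equality
      t ⁻¹ * (t * (1# + δ) - t)   ≡⟨ solve 3 (λ i t δ → i :* (t :* (:1 :+ δ) :- t) := (i :* t) :* δ) refl (t ⁻¹) t δ ⟩
      t ⁻¹ * t * δ                ≡⟨ trans (cong (_* δ) (⁻¹-inverseˡ (pos⇒≢0 0<t))) (*-identityˡ δ) ⟩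
      δ                           ∎)) (log-upper 0<t (<⇒≤ t<t′))
      where
      t<t′ : t < t * (1# + δ)
      t<t′ = subst₂ _<_ (+-identityʳ t) (solve 2 (λ t δ → t :+ t :* δ := t :* (:1 :+ δ)) refl t δ)
               (+-monoʳ-< t (*-pos 0<t 0<δ))
    not-below : ¬ log s < y
    not-below logs<y = <⇒≱ s<s′ (ub _ (<-trans 0<s s<s′ ,
      ≤-trans logs′≤ (reflexive (solve 2 (λ l y → l :+ (y :- l) := y) refl (log s) y))))
      where
      s<s′ = proj₁ (grow 0<s (x<y⇒0<y-x logs<y))
      logs′≤ = proj₂ (grow 0<s (x<y⇒0<y-x logs<y))
    not-above : ¬ y < log s
    not-above y<logs = <⇒≱ s′<s (least s′ λ x (0<x , logx≤y) →
      ≮⇒≥ λ s′<x → <⇒≱ (log-mono-< 0<s′ s′<x) (≤-trans logx≤y y≤logs′))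
      where
      δ s′ : ℝ
      δ = log s - y
      0<δ : 0# < δ
      0<δ = x<y⇒0<y-x y<logs
      0<1+δ : 0# < 1# + δ
      0<1+δ = <-trans 0<1 (subst (_< 1# + δ) (+-identityʳ 1#) (+-monoʳ-< 1# 0<δ))
      s′ = s / (1# + δ)
      0<s′ : 0# < s′
      0<s′ = /-pos 0<s 0<1+δ
      back : s′ * (1# + δ) ≡ s
      back = x/y*y≡x s 0<1+δ
      s′<s : s′ < s
      s′<s = subst (s′ <_) back (proj₁ (grow 0<s′ 0<δ))
      y≤logs′ : y ≤ log s′
      y≤logs′ = begin
        y              ≡⟨ solve 2 (λ l y → y := l :- (l :- y)) refl (log s) y ⟩
        log s - δ      ≤⟨ +-monoˡ-≤ (- δ) (subst (λ z → log z ≤ log s′ + δ) back (proj₂ (grow 0<s′ 0<δ))) ⟩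
        log s′ + δ - δ ≡⟨ x+z-z≡x _ δ ⟩
        log s′         ∎

  log-surjective-nonNeg : ∀ {y} → 0# ≤ y → ∃ λ x → 0# < x × log x ≡ y
  log-surjective-nonNeg {y} 0≤y = proj₁ sup , log-sup 0≤y (proj₂ sup)
    where
    n = proj₁ (archimedean y)
    bound = log-unbounded n
    sup : ∃ (IsSup _≤_ (λ x → 0# < x × log x ≤ y))
    sup = complete _ (1# , 0<1 , subst (_≤ y) (sym log-1) 0≤y)
      (proj₁ bound , λ x (_ , logx≤y) → log-cancel-≤ (proj₁ (proj₂ bound))
        (≤-trans logx≤y (≤-trans (<⇒≤ (proj₂ (archimedean y))) (proj₂ (proj₂ bound)))))

  log-⁻¹ : ∀ {x} → 0# < x → log (x ⁻¹) ≡ - log x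
  log-⁻¹ {x} 0<x = begin-equality
    log (x ⁻¹)                    ≡⟨ solve 2 (λ a b → a := (b :+ a) :- b) refl _ (log x) ⟩
    log x + log (x ⁻¹) - log x    ≡⟨ cong (_- log x) (log-* 0<x (⁻¹-pos 0<x)) ⟨
    log (x * x ⁻¹) - log x        ≡⟨ cong (λ z → log z - log x) (⁻¹-inverseʳ x (pos⇒≢0 0<x)) ⟩
    log 1# - log x                ≡⟨ trans (cong (_- log x) log-1) (+-identityˡ _) ⟩
    - log x                       ∎

  log-surjective : ∀ y → ∃ λ x → 0# < x × log x ≡ y
  log-surjective y = [ log-surjective-nonNeg , (λ y≤0 → negate (log-surjective-nonNeg (x≤0⇒0≤-x y≤0))) ]′ (total 0# y)
    where
    negate : (∃ λ x → 0# < x × log x ≡ - y) → ∃ λ x → 0# < x × log x ≡ y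
    negate (x , 0<x , logx≡-y) = x ⁻¹ , ⁻¹-pos 0<x ,
      trans (log-⁻¹ 0<x) (trans (cong -_ logx≡-y) (solve 1 (λ y → :- :- y := y) refl y))

  -- The exponential function and powers

  exp-pos : ∀ y → 0# < exp y
  exp-pos y = proj₁ (the-satisfies {λ x → 0# < x × log x ≡ y} (log-surjective y))

  log-exp : ∀ y → log (exp y) ≡ y
  log-exp y = proj₂ (the-satisfies {λ x → 0# < x × log x ≡ y} (log-surjective y))

  exp-+ : ∀ x y → exp (x + y) ≡ exp x * exp y
  exp-+ x y = log-injective (exp-pos _) (*-pos (exp-pos x) (exp-pos y)) (begin-equality
    log (exp (x + y))           ≡⟨ log-exp _ ⟩
    x + y                       ≡⟨ cong₂ _+_ (log-exp x) (log-exp y) ⟨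
    log (exp x) + log (exp y)   ≡⟨ log-* (exp-pos x) (exp-pos y) ⟨
    log (exp x * exp y)         ∎)

  exp-mono-≤ : ∀ {x y} → x ≤ y → exp x ≤ exp y
  exp-mono-≤ {x} {y} x≤y = log-cancel-≤ (exp-pos y) (subst₂ _≤_ (sym (log-exp x)) (sym (log-exp y)) x≤y)

  exp-neg : ∀ y → exp (- y) ≡ exp y ⁻¹
  exp-neg y = log-injective (exp-pos _) (⁻¹-pos (exp-pos y))
    (trans (log-exp _) (sym (trans (log-⁻¹ (exp-pos y)) (cong -_ (log-exp y)))))

  ^-pos : ∀ x y → 0# < x ^ y
  ^-pos x y = exp-pos _

  ^-monoˡ-≤ : ∀ {x y m} → 0# ≤ m → 0# < x → x ≤ y → x ^ m ≤ y ^ m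
  ^-monoˡ-≤ 0≤m 0<x x≤y = exp-mono-≤ (*-monoʳ-≤ 0≤m (log-mono-≤ 0<x x≤y))

  ^-distribʳ-* : ∀ y {u v} → 0# < u → 0# < v → (u * v) ^ y ≡ u ^ y * v ^ y
  ^-distribʳ-* y {u} {v} 0<u 0<v = trans
    (cong exp (trans (cong (y *_) (log-* 0<u 0<v)) (distribˡ y _ _))) (exp-+ _ _)

  ^-neg : ∀ x y → x ^ (- y) ≡ (x ^ y) ⁻¹
  ^-neg x y = trans (cong exp (solve 2 (λ y l → :- y :* l := :- (y :* l)) refl y (log x))) (exp-neg _)

  ⁻¹-^ : ∀ {x} y → 0# < x → (x ⁻¹) ^ y ≡ x ^ (- y)
  ⁻¹-^ {x} y 0<x = cong exp (trans (cong (y *_) (log-⁻¹ 0<x)) (solve 2 (λ y l → y :* :- l := :- y :* l) refl y (log x)))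

  1^ : ∀ y → 1# ^ y ≡ 1#
  1^ y = log-injective (exp-pos _) 0<1
    (trans (log-exp _) (trans (cong (y *_) log-1) (trans (zeroʳ y) (sym log-1))))

  -- The factor `e` shifts the logarithm to 1 + log x ≥ 1, which makes it a legitimate base for
  -- `_^_`.
  0<log[ex] : ∀ {x} → 1# ≤ x → 0# < log (e * x)
  0<log[ex] {x} 1≤x = subst (0# <_) (sym (log-* (exp-pos 1#) 0<x))
    (<-≤-trans (subst (0# <_) (sym (log-exp 1#)) 0<1)
      (subst (_≤ log e + log x) (+-identityʳ _) (+-monoʳ-≤ (log e)
        (subst (_≤ log x) log-1 (log-mono-≤ 0<1 1≤x)))))
    where 0<x = <-≤-trans 0<1 1≤x

-- Absolute values, finite sums, series and Dirichlet convolution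

module Sums (em : ExcludedMiddle 0ℓ) (R : CompleteOrderedField) where

  open Logarithm em R public

  -- Absolute values

  ∣∣-cases : ∀ x → (0# ≤ x × ∣ x ∣ ≡ x) ⊎ (x ≤ 0# × ∣ x ∣ ≡ - x)
  ∣∣-cases x with em {0# ≤ x}
  ... | yes 0≤x = inj₁ (0≤x , refl)
  ... | no  0≰x = inj₂ (<⇒≤ (≰⇒> 0≰x) , refl)

  0≤∣x∣ : ∀ x → 0# ≤ ∣ x ∣
  0≤∣x∣ x with ∣∣-cases x
  ... | inj₁ (0≤x , eq) = subst (0# ≤_) (sym eq) 0≤x
  ... | inj₂ (x≤0 , eq) = subst (0# ≤_) (sym eq) (x≤0⇒0≤-x x≤0)

  0≤x⇒∣x∣≡x : ∀ {x} → 0# ≤ x → ∣ x ∣ ≡ x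
  0≤x⇒∣x∣≡x {x} 0≤x with em {0# ≤ x}
  ... | yes _   = refl
  ... | no  0≰x = ⊥-elim (0≰x 0≤x)

  x≤0⇒∣x∣≡-x : ∀ {x} → x ≤ 0# → ∣ x ∣ ≡ - x
  x≤0⇒∣x∣≡-x {x} x≤0 with ∣∣-cases x
  ... | inj₂ (_ , eq) = eq
  ... | inj₁ (0≤x , eq) = trans eq (trans x≡0 (trans (solve 0 (:0 := :- :0) refl) (cong -_ (sym x≡0))))
    where x≡0 = antisym x≤0 0≤x

  x≤∣x∣ : ∀ x → x ≤ ∣ x ∣
  x≤∣x∣ x with ∣∣-cases x
  ... | inj₁ (_ , eq)   = reflexive (sym eq)
  ... | inj₂ (x≤0 , eq) = ≤-trans x≤0 (0≤∣x∣ x)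

  -x≤∣x∣ : ∀ x → - x ≤ ∣ x ∣
  -x≤∣x∣ x with ∣∣-cases x
  ... | inj₁ (0≤x , _) = ≤-trans (0≤x⇒-x≤0 0≤x) (0≤∣x∣ x)
  ... | inj₂ (_ , eq)  = reflexive (sym eq)

  ∣x∣≤ : ∀ {x c} → x ≤ c → - x ≤ c → ∣ x ∣ ≤ c
  ∣x∣≤ {x} {c} x≤c -x≤c with ∣∣-cases x
  ... | inj₁ (_ , eq) = subst (_≤ c) (sym eq) x≤c
  ... | inj₂ (_ , eq) = subst (_≤ c) (sym eq) -x≤c

  ∣x+y∣≤∣x∣+∣y∣ : ∀ x y → ∣ x + y ∣ ≤ ∣ x ∣ + ∣ y ∣
  ∣x+y∣≤∣x∣+∣y∣ x y = ∣x∣≤ (+-mono-≤ (x≤∣x∣ x) (x≤∣x∣ y))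
    (≤-trans (reflexive (solve 2 (λ x y → :- (x :+ y) := :- x :+ :- y) refl x y)) (+-mono-≤ (-x≤∣x∣ x) (-x≤∣x∣ y)))

  ∣-x∣≡∣x∣ : ∀ x → ∣ - x ∣ ≡ ∣ x ∣
  ∣-x∣≡∣x∣ x with ∣∣-cases x
  ... | inj₁ (0≤x , eq) = trans (x≤0⇒∣x∣≡-x (0≤x⇒-x≤0 0≤x)) (trans (solve 1 (λ x → :- :- x := x) refl x) (sym eq))
  ... | inj₂ (x≤0 , eq) = trans (0≤x⇒∣x∣≡x (x≤0⇒0≤-x x≤0)) (sym eq)

  ∣x*y∣≡∣x∣*∣y∣ : ∀ x y → ∣ x * y ∣ ≡ ∣ x ∣ * ∣ y ∣
  ∣x*y∣≡∣x∣*∣y∣ x y with ∣∣-cases x | ∣∣-cases y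
  ... | inj₁ (0≤x , ex) | inj₁ (0≤y , ey) = trans (0≤x⇒∣x∣≡x (*-nonNeg 0≤x 0≤y)) (sym (cong₂ _*_ ex ey))
  ... | inj₁ (0≤x , ex) | inj₂ (y≤0 , ey) = trans (sym (∣-x∣≡∣x∣ (x * y)))
        (trans (cong ∣_∣ (solve 2 (λ x y → :- (x :* y) := x :* :- y) refl x y))
          (trans (0≤x⇒∣x∣≡x (*-nonNeg 0≤x (x≤0⇒0≤-x y≤0))) (sym (cong₂ _*_ ex ey))))
  ... | inj₂ (x≤0 , ex) | inj₁ (0≤y , ey) = trans (sym (∣-x∣≡∣x∣ (x * y)))
        (trans (cong ∣_∣ (solve 2 (λ x y → :- (x :* y) := :- x :* y) refl x y))
          (trans (0≤x⇒∣x∣≡x (*-nonNeg (x≤0⇒0≤-x x≤0) 0≤y)) (sym (cong₂ _*_ ex ey))))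
  ... | inj₂ (x≤0 , ex) | inj₂ (y≤0 , ey) =
        trans (cong ∣_∣ (solve 2 (λ x y → x :* y := :- x :* :- y) refl x y))
          (trans (0≤x⇒∣x∣≡x (*-nonNeg (x≤0⇒0≤-x x≤0) (x≤0⇒0≤-x y≤0))) (sym (cong₂ _*_ ex ey)))

  ∣0∣≡0 : ∣ 0# ∣ ≡ 0#
  ∣0∣≡0 = 0≤x⇒∣x∣≡x ≤-refl

  x≢0⇒0<∣x∣ : ∀ {x} → x ≢ 0# → 0# < ∣ x ∣
  x≢0⇒0<∣x∣ {x} x≢0 with ∣∣-cases x
  ... | inj₁ (0≤x , eq) = subst (0# <_) (sym eq) (0≤x , x≢0 ∘ sym)
  ... | inj₂ (x≤0 , eq) = 0≤∣x∣ x , λ 0≡∣x∣ → x≢0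
        (trans (solve 1 (λ x → x := :- :- x) refl x)
          (trans (cong -_ (trans (sym eq) (sym 0≡∣x∣))) (solve 0 (:- :0 := :0) refl)))

  -- Finite sums

  ∑-cong : ∀ {c d} n → (∀ j → 1 ℕ.≤ j → j ℕ.≤ n → c j ≡ d j) → ∑ n c ≡ ∑ n d
  ∑-cong zero    eq = refl
  ∑-cong (suc n) eq = cong₂ _+_ (∑-cong n λ j 1≤j j≤n → eq j 1≤j (ℕₚ.m≤n⇒m≤1+n j≤n)) (eq (suc n) (s≤s z≤n) ℕₚ.≤-refl)

  ∑-mono-≤ : ∀ {c d} n → (∀ j → 1 ℕ.≤ j → j ℕ.≤ n → c j ≤ d j) → ∑ n c ≤ ∑ n d
  ∑-mono-≤ zero    le = ≤-refl
  ∑-mono-≤ (suc n) le = +-mono-≤ (∑-mono-≤ n λ j 1≤j j≤n → le j 1≤j (ℕₚ.m≤n⇒m≤1+n j≤n)) (le (suc n) (s≤s z≤n) ℕₚ.≤-refl)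

  ∑-zero : ∀ {c} n → (∀ j → 1 ℕ.≤ j → j ℕ.≤ n → c j ≡ 0#) → ∑ n c ≡ 0#
  ∑-zero zero    eq = refl
  ∑-zero (suc n) eq = trans (cong₂ _+_ (∑-zero n λ j 1≤j j≤n → eq j 1≤j (ℕₚ.m≤n⇒m≤1+n j≤n)) (eq (suc n) (s≤s z≤n) ℕₚ.≤-refl))
                        (+-identityˡ 0#)

  ∑-+ : ∀ n c d → ∑ n (λ j → c j + d j) ≡ ∑ n c + ∑ n d
  ∑-+ zero    c d = sym (+-identityˡ 0#)
  ∑-+ (suc n) c d = trans (cong (_+ (c (suc n) + d (suc n))) (∑-+ n c d))
    (solve 4 (λ s t x y → s :+ t :+ (x :+ y) := s :+ x :+ (t :+ y)) refl (∑ n c) (∑ n d) (c (suc n)) (d (suc n)))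

  ∑-*ˡ : ∀ n k c → ∑ n (λ j → k * c j) ≡ k * ∑ n c
  ∑-*ˡ zero    k c = sym (zeroʳ k)
  ∑-*ˡ (suc n) k c = trans (cong (_+ k * c (suc n)) (∑-*ˡ n k c)) (sym (distribˡ k _ _))

  ∑-*ʳ : ∀ n k c → ∑ n (λ j → c j * k) ≡ ∑ n c * k
  ∑-*ʳ n k c = trans (∑-cong n λ j _ _ → *-comm (c j) k) (trans (∑-*ˡ n k c) (*-comm k _))

  ∑-swap : ∀ m n (f : ℕ → ℕ → ℝ) → ∑ m (λ i → ∑ n (f i)) ≡ ∑ n (λ j → ∑ m (λ i → f i j))
  ∑-swap zero    n f = sym (∑-zero n λ _ _ _ → refl)
  ∑-swap (suc m) n f = trans (cong (_+ ∑ n (f (suc m))) (∑-swap m n f)) (sym (∑-+ n _ (f (suc m))))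

  ∣∑∣≤∑∣∣ : ∀ n c → ∣ ∑ n c ∣ ≤ ∑ n (λ j → ∣ c j ∣)
  ∣∑∣≤∑∣∣ zero    c = reflexive ∣0∣≡0
  ∣∑∣≤∑∣∣ (suc n) c = ≤-trans (∣x+y∣≤∣x∣+∣y∣ (∑ n c) (c (suc n))) (+-monoˡ-≤ _ (∣∑∣≤∑∣∣ n c))

  ∑-extend : ∀ {c N n} → (∀ j → N ℕ.< j → c j ≡ 0#) → N ℕ.≤ n → ∑ n c ≡ ∑ N c
  ∑-extend {c} {N} vanish N≤n = go (ℕₚ.≤⇒≤′ N≤n)
    where
    go : ∀ {n} → N ℕ.≤′ n → ∑ n c ≡ ∑ N c
    go ℕ.≤′-refl       = refl
    go (ℕ.≤′-step {n = n} N≤n) = trans (cong₂ _+_ (go N≤n) (vanish (suc n) (s≤s (ℕₚ.≤′⇒≤ N≤n)))) (+-identityʳ _)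

  ∑-mono-length : ∀ {c m n} → (∀ j → 0# ≤ c j) → m ℕ.≤ n → ∑ m c ≤ ∑ n c
  ∑-mono-length {c} {m} 0≤c m≤n = go (ℕₚ.≤⇒≤′ m≤n)
    where
    go : ∀ {n} → m ℕ.≤′ n → ∑ m c ≤ ∑ n c
    go ℕ.≤′-refl       = ≤-refl
    go (ℕ.≤′-step {n = n} m≤n) = ≤-trans (go m≤n)
      (subst (_≤ ∑ n c + c (suc n)) (+-identityʳ _) (+-monoʳ-≤ (∑ n c) (0≤c (suc n))))

  ∑-nonNeg : ∀ {c} n → (∀ j → 0# ≤ c j) → 0# ≤ ∑ n c
  ∑-nonNeg n 0≤c = ∑-mono-length {n = n} 0≤c z≤n

  ∑-head : ∀ n c → ∑ (suc n) c ≡ c 1 + ∑ n (c ∘ suc)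
  ∑-head zero    c = +-comm 0# (c 1)
  ∑-head (suc n) c = trans (cong (_+ c (suc (suc n))) (∑-head n c)) (+-assoc _ _ _)

  -- Series

  0≤x<ε⇒x≡0 : ∀ {x} → 0# ≤ x → (∀ ε → 0# < ε → x < ε) → x ≡ 0#
  0≤x<ε⇒x≡0 {x} 0≤x small with em {x ≡ 0#}
  ... | yes x≡0 = x≡0
  ... | no  x≢0 = ⊥-elim (<-irrefl (small x (0≤x , x≢0 ∘ sym)))

  HasSum-unique : ∀ {c S T} → HasSum c S → HasSum c T → S ≡ T
  HasSum-unique {c} {S} {T} hS hT = x-y≡0⇒x≡y (∣x∣≡0⇒x≡0 (0≤x<ε⇒x≡0 (0≤∣x∣ _) close))
    where
    ∣x∣≡0⇒x≡0 : ∀ {x} → ∣ x ∣ ≡ 0# → x ≡ 0#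
    ∣x∣≡0⇒x≡0 {x} eq with em {x ≡ 0#}
    ... | yes x≡0 = x≡0
    ... | no  x≢0 = ⊥-elim (proj₂ (x≢0⇒0<∣x∣ x≢0) (sym eq))
    close : ∀ ε → 0# < ε → ∣ S - T ∣ < ε
    close ε 0<ε = ≤-<-trans
      (≤-trans (reflexive (trans (sym (∣-x∣≡∣x∣ (S - T))) (cong ∣_∣
        (solve 3 (λ s t x → :- (s :- t) := (x :- s) :+ :- (x :- t)) refl S T (∑ n c)))))
        (≤-trans (∣x+y∣≤∣x∣+∣y∣ (∑ n c - S) (- (∑ n c - T))) (+-monoʳ-≤ _ (reflexive (∣-x∣≡∣x∣ _)))))
      (<-≤-trans (+-mono-< (proj₂ (hS h 0<h) n (ℕₚ.m≤m⊔n _ _)) (proj₂ (hT h 0<h) n (ℕₚ.m≤n⊔m _ _)))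
        (reflexive (sym (halves ε))))
      where
      h = ε / 2#
      0<h : 0# < h
      0<h = /-pos 0<ε 0<2
      n = proj₁ (hS h 0<h) ℕ.⊔ proj₁ (hT h 0<h)

  HasSum⇒∑∞ : ∀ {c S} → HasSum c S → ∑∞ c ≡ S
  HasSum⇒∑∞ {c} {S} h = HasSum-unique (the-satisfies {HasSum c} (S , h)) h

  HasSum-finite : ∀ {c} N → (∀ j → N ℕ.< j → c j ≡ 0#) → HasSum c (∑ N c)
  HasSum-finite {c} N vanish ε 0<ε = N , λ n N≤n → subst (_< ε)
    (sym (trans (cong (λ z → ∣ z - ∑ N c ∣) (∑-extend vanish N≤n)) (trans (cong ∣_∣ (-‿inverseʳ _)) ∣0∣≡0))) 0<ε

  -- A partial sum above `S` would keep all later ones above `S` by at least the same margin.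
  ∑≤HasSum : ∀ {c S} → (∀ j → 0# ≤ c j) → HasSum c S → ∀ n → ∑ n c ≤ S
  ∑≤HasSum {c} {S} 0≤c h n = ≮⇒≥ λ S<∑ →
    let N , close = h (∑ n c - S) (x<y⇒0<y-x S<∑)
        k = n ℕ.⊔ N in
    <⇒≱ (close k (ℕₚ.m≤n⊔m n N)) (≤-trans (+-monoˡ-≤ (- S) (∑-mono-length 0≤c (ℕₚ.m≤m⊔n n N))) (x≤∣x∣ _))

  -- Monotone convergence: the limit is the supremum of the partial sums.
  bounded⇒HasSum : ∀ {c B} → (∀ j → 0# ≤ c j) → (∀ n → ∑ n c ≤ B) → ∃ (HasSum c)
  bounded⇒HasSum {c} {B} 0≤c bounded = proj₁ sup , converges (proj₂ sup)
    where
    sup : ∃ (IsSup _≤_ (λ x → ∃ λ n → x ≡ ∑ n c))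
    sup = complete _ (0# , 0 , refl) (B , λ { _ (n , refl) → bounded n })
    converges : ∀ {S} → IsSup _≤_ (λ x → ∃ λ n → x ≡ ∑ n c) S → HasSum c S
    converges {S} (ub , least) ε 0<ε with em {∃ λ N → S - ε < ∑ N c}
    -- Otherwise `S - ε` would be an upper bound smaller than the supremum.
    ... | no  none = ⊥-elim (<⇒≱ 0<ε (+-cancelʳ-≤ (S - ε) (subst₂ _≤_
          (solve 2 (λ s e → s := e :+ (s :- e)) refl S ε) (sym (+-identityˡ _))
          (least (S - ε) λ { _ (n , refl) → ≮⇒≥ λ lt → none (n , lt) }))))
    ... | yes (N , S-ε<∑) = N , λ n N≤n → subst (_< ε)
          (sym (trans (x≤0⇒∣x∣≡-x (x≤y+z⇒x-y≤z (subst (∑ n c ≤_) (sym (+-identityʳ S)) (ub _ (n , refl)))))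
            (solve 2 (λ p s → :- (p :- s) := s :- p) refl (∑ n c) S)))
          (subst₂ _<_ (solve 3 (λ s e p → s :- e :+ (e :- p) := s :- p) refl S ε (∑ n c))
            (solve 2 (λ e p → p :+ (e :- p) := e) refl ε (∑ n c))
            (+-monoˡ-< (ε - ∑ n c) (<-≤-trans S-ε<∑ (∑-mono-length 0≤c N≤n))))

  -- Dirichlet convolution

  -- Kronecker delta. It turns the divisibility condition in a convolution into a factor, so that
  -- sums over divisors become sums over a full square and can be interchanged.
  δ : ℕ → ℕ → ℝ
  δ m n with m ℕₚ.≟ n
  ... | yes _ = 1#
  ... | no  _ = 0#

  δ-≡ : ∀ {m n} → m ≡ n → δ m n ≡ 1#
  δ-≡ {m} {n} m≡n with m ℕₚ.≟ n
  ... | yes _   = refl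
  ... | no  m≢n = ⊥-elim (m≢n m≡n)

  δ-≢ : ∀ {m n} → m ≢ n → δ m n ≡ 0#
  δ-≢ {m} {n} m≢n with m ℕₚ.≟ n
  ... | yes m≡n = ⊥-elim (m≢n m≡n)
  ... | no  _   = refl

  0≤δ : ∀ m n → 0# ≤ δ m n
  0≤δ m n with m ℕₚ.≟ n
  ... | yes _ = <⇒≤ 0<1
  ... | no  _ = ≤-refl

  δ*-cong : ∀ {m n x y} → (m ≡ n → x ≡ y) → δ m n * x ≡ δ m n * y
  δ*-cong {m} {n} {x} {y} f with m ℕₚ.≟ n
  ... | yes m≡n = cong (1# *_) (f m≡n)
  ... | no  _   = trans (zeroˡ x) (sym (zeroˡ y))

  ∑-δ-vanish : ∀ {m} N (h : Seq) → N ℕ.< m → ∑ N (λ n → δ m n * h n) ≡ 0#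
  ∑-δ-vanish N h N<m = ∑-zero N λ j _ j≤N →
    trans (cong (_* h j) (δ-≢ (ℕₚ.>⇒≢ (ℕₚ.≤-<-trans j≤N N<m)))) (zeroˡ _)

  ∑-δ : ∀ {m} N (h : Seq) → 1 ℕ.≤ m → m ℕ.≤ N → ∑ N (λ n → δ m n * h n) ≡ h m
  ∑-δ zero    h (s≤s _) ()
  ∑-δ {m} (suc N) h 1≤m m≤1+N with ℕₚ.m≤n⇒m<n∨m≡n m≤1+N
  ... | inj₁ (s≤s m≤N) = trans (cong₂ _+_ (∑-δ N h 1≤m m≤N)
          (trans (cong (_* h (suc N)) (δ-≢ (ℕₚ.<⇒≢ (s≤s m≤N)))) (zeroˡ _))) (+-identityʳ _)
  ... | inj₂ refl = trans (cong₂ _+_ (∑-δ-vanish N h ℕₚ.≤-refl)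
          (trans (cong (_* h (suc N)) (δ-≡ {m} refl)) (*-identityˡ _))) (+-identityˡ _)

  private
    -- Unifying `S` with `∑ n c` recovers the implicit `c`, so a summand can be named although its
    -- definition is out of scope.
    summandOf : ∀ {n c S} → S ≡ ∑ n c → Seq
    summandOf {c = c} _ = c

    -- The summand of (c ∗ d) n, which Defs hides in a where clause.
    term : Seq → Seq → ℕ → Seq
    term c d n = summandOf {n} {S = (c ∗ d) n} refl

    -- At most one `j` satisfies r j = n, namely the quotient, and it is at most n ≤ N.
    term-expand : ∀ c d {n N} r → 1 ℕ.≤ r → 1 ℕ.≤ n → n ℕ.≤ N →
                  term c d n r ≡ ∑ N (λ j → δ (r ℕ.* j) n * (c r * d j))
    term-expand c d {n} {N} r 1≤r 1≤n n≤N with r ∣? n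
    ... | no  r∤n = sym (∑-zero N λ j _ _ → trans (cong (_* (c r * d j))
          (δ-≢ λ rj≡n → r∤n (divides j (trans (sym rj≡n) (ℕₚ.*-comm r j))))) (zeroˡ _))
    ... | yes (divides q n≡qr) = sym (trans (∑-cong N λ j _ _ → cong (_* (c r * d j)) (δ-eq j))
            (∑-δ N (λ j → c r * d j) 1≤q q≤N))
      where
      1≤q : 1 ℕ.≤ q
      1≤q = ℕₚ.n≢0⇒n>0 λ { refl → ℕₚ.<⇒≢ 1≤n (sym n≡qr) }
      q≤N : q ℕ.≤ N
      q≤N = ℕₚ.≤-trans (ℕₚ.m≤m*n q r {{ℕ.>-nonZero 1≤r}}) (ℕₚ.≤-trans (ℕₚ.≤-reflexive (sym n≡qr)) n≤N)
      δ-eq : ∀ j → δ (r ℕ.* j) n ≡ δ q j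
      δ-eq j with q ℕₚ.≟ j
      ... | yes refl = δ-≡ (trans (ℕₚ.*-comm r q) (sym n≡qr))
      ... | no  q≢j  = δ-≢ λ rj≡n → q≢j (ℕₚ.*-cancelʳ-≡ q j r {{ℕ.>-nonZero 1≤r}}
                         (trans (sym n≡qr) (trans (sym rj≡n) (ℕₚ.*-comm r j))))

  -- A common bound `N` independent of `n` is what permits exchanging sums later. Rows with r > n
  -- add nothing, because r j ≥ r for j ≥ 1.
  ∗-expand : ∀ c d {n N} → 1 ℕ.≤ n → n ℕ.≤ N →
             (c ∗ d) n ≡ ∑ N (λ r → ∑ N (λ j → δ (r ℕ.* j) n * (c r * d j)))
  ∗-expand c d {n} {N} 1≤n n≤N = trans
    (∑-cong n λ r 1≤r _ → term-expand c d r 1≤r 1≤n n≤N)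
    (sym (∑-extend X-vanish n≤N))
    where
    X : Seq
    X r = ∑ N (λ j → δ (r ℕ.* j) n * (c r * d j))
    X-vanish : ∀ r → n ℕ.< r → X r ≡ 0#
    X-vanish r n<r = ∑-zero N λ j 1≤j _ → trans (cong (_* (c r * d j))
      (δ-≢ (ℕₚ.>⇒≢ (ℕₚ.<-≤-trans n<r (ℕₚ.m≤m*n r j {{ℕ.>-nonZero 1≤j}}))))) (zeroˡ _)

  -- The innermost sum is h(r j) if r j ≤ N and 0 otherwise. It is left unevaluated because it is
  -- used in two ways: as exactly h(r j) when `h` vanishes beyond `N`, and as at most 1 when `h` is
  -- constantly 1.
  ∑-∗-* : ∀ c d N (h : Seq) → ∑ N (λ n → (c ∗ d) n * h n) ≡
          ∑ N (λ r → ∑ N (λ j → c r * d j * ∑ N (λ n → δ (r ℕ.* j) n * h n)))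
  ∑-∗-* c d N h = begin-equality
    ∑ N (λ n → (c ∗ d) n * h n)
      ≡⟨ ∑-cong N (λ n 1≤n n≤N → trans (cong (_* h n) (∗-expand c d 1≤n n≤N))
           (trans (sym (∑-*ʳ N (h n) _)) (∑-cong N λ r _ _ → sym (∑-*ʳ N (h n) _)))) ⟩
    ∑ N (λ n → ∑ N (λ r → ∑ N (λ j → δ (r ℕ.* j) n * (c r * d j) * h n)))
      ≡⟨ ∑-swap N N _ ⟩
    ∑ N (λ r → ∑ N (λ n → ∑ N (λ j → δ (r ℕ.* j) n * (c r * d j) * h n)))
      ≡⟨ ∑-cong N (λ r _ _ → ∑-swap N N _) ⟩
    ∑ N (λ r → ∑ N (λ j → ∑ N (λ n → δ (r ℕ.* j) n * (c r * d j) * h n)))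
      ≡⟨ ∑-cong N (λ r _ _ → ∑-cong N λ j _ _ → trans
           (∑-cong N λ n _ _ → solve 3 (λ p q s → p :* q :* s := q :* (p :* s)) refl (δ (r ℕ.* j) n) (c r * d j) (h n))
           (∑-*ˡ N (c r * d j) _)) ⟩
    ∑ N (λ r → ∑ N (λ j → c r * d j * ∑ N (λ n → δ (r ℕ.* j) n * h n)))
      ∎

  ∑-∗-reindex : ∀ c d N (h : Seq) → (∀ n → N ℕ.< n → h n ≡ 0#) →
                ∑ N (λ n → (c ∗ d) n * h n) ≡ ∑ N (λ r → ∑ N (λ j → c r * d j * h (r ℕ.* j)))
  ∑-∗-reindex c d N h vanish = trans (∑-∗-* c d N h)
    (∑-cong N λ r 1≤r _ → ∑-cong N λ j 1≤j _ → cong (c r * d j *_) (pick (r ℕ.* j) (ℕₚ.*-mono-≤ 1≤r 1≤j)))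
    where
    pick : ∀ m → 1 ℕ.≤ m → ∑ N (λ n → δ m n * h n) ≡ h m
    pick m 1≤m = [ ∑-δ N h 1≤m , (λ N<m → trans (∑-δ-vanish N h N<m) (sym (vanish m N<m))) ]′ (ℕₚ.≤-<-connex m N)

  -- The left side collects only the pairs with r j ≤ N, the product on the right all pairs of the
  -- square; the entries are nonnegative.
  ∑-∗-≤ : ∀ {c d} → (∀ j → 0# ≤ c j) → (∀ j → 0# ≤ d j) → ∀ N → ∑ N (c ∗ d) ≤ ∑ N c * ∑ N d
  ∑-∗-≤ {c} {d} 0≤c 0≤d N = begin
    ∑ N (c ∗ d)
      ≡⟨ ∑-cong N (λ n _ _ → sym (*-identityʳ _)) ⟩
    ∑ N (λ n → (c ∗ d) n * 1#)
      ≡⟨ ∑-∗-* c d N (λ _ → 1#) ⟩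
    ∑ N (λ r → ∑ N (λ j → c r * d j * ∑ N (λ n → δ (r ℕ.* j) n * 1#)))
      ≤⟨ ∑-mono-≤ N (λ r 1≤r _ → ∑-mono-≤ N λ j 1≤j _ →
           *-monoʳ-≤ (*-nonNeg (0≤c r) (0≤d j)) (≤1 (r ℕ.* j) (ℕₚ.*-mono-≤ 1≤r 1≤j))) ⟩
    ∑ N (λ r → ∑ N (λ j → c r * d j * 1#))
      ≡⟨ ∑-cong N (λ r _ _ → trans (∑-cong N λ j _ _ → *-identityʳ _) (∑-*ˡ N (c r) d)) ⟩
    ∑ N (λ r → c r * ∑ N d)
      ≡⟨ ∑-*ʳ N (∑ N d) c ⟩
    ∑ N c * ∑ N d
      ∎
    where
    ≤1 : ∀ m → 1 ℕ.≤ m → ∑ N (λ n → δ m n * 1#) ≤ 1#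
    ≤1 m 1≤m = [ (λ m≤N → reflexive (∑-δ N _ 1≤m m≤N)) ,
                 (λ N<m → ≤-trans (reflexive (∑-δ-vanish N _ N<m)) (<⇒≤ 0<1)) ]′ (ℕₚ.≤-<-connex m N)

-- Simplicial vertices of the gcd graph and their true-twin classes

module SimplicialClasses where

  open import Data.Nat.Base
  open import Data.Nat.Divisibility using (_∣_; ∣⇒≤; ∣-trans; ∣-refl; m∣m*n)
  open import Data.Nat.DivMod using (_/_; m/n*n≤m; /-monoˡ-≤; /-monoʳ-≤; m*n/n≡m; n/1≡n)
  open import Data.Nat.Properties

  unique∧set⇒length : ∀ {A : Set} {xs ys : List A} → Unique xs → Unique ys →
                      (∀ {z} → z ∈ xs → z ∈ ys) → (∀ {z} → z ∈ ys → z ∈ xs) → length xs ≡ length ys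
  unique∧set⇒length xs! ys! to from = ↭-length (∼bag⇒↭ (unique∧set⇒bag xs! ys! (mk⇔ to from)))

  deduplicate-pairwise : ∀ {A : Set} {R : Rel A 0ℓ} (R? : Decidable R) xs →
                         AllPairs (λ x y → ¬ R x y) (deduplicate R? xs)
  deduplicate-pairwise R? []       = []
  deduplicate-pairwise R? (x ∷ xs) =
    Allₚ.all-filter (¬? ∘ R? x) (deduplicate R? xs) ∷ AllPairsₚ.filter⁺ (¬? ∘ R? x) (deduplicate-pairwise R? xs)

  AllPairs-map-All : ∀ {A : Set} {P : A → Set} {R S : Rel A 0ℓ} {xs} →
                     (∀ {x y} → P x → P y → R x y → S x y) → All P xs → AllPairs R xs → AllPairs S xs
  AllPairs-map-All f []         []       = []
  AllPairs-map-All f (px ∷ pxs) (r ∷ rs) =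
    All.zipWith (λ (py , rxy) → f px py rxy) (pxs , r) ∷ AllPairs-map-All f pxs rs

  ≤/⇒*≤ : ∀ {q} n m .{{_ : NonZero m}} → q ≤ n / m → q * m ≤ n
  ≤/⇒*≤ n m q≤ = ≤-trans (*-monoˡ-≤ m q≤) (m/n*n≤m n m)

  *≤⇒≤/ : ∀ {q} n m .{{_ : NonZero m}} → q * m ≤ n → q ≤ n / m
  *≤⇒≤/ {q} n m le = subst (_≤ n / m) (m*n/n≡m q m) (/-monoˡ-≤ m le)

  prime>1 : ∀ {p} → Prime p → 1 < p
  prime>1 pp = nonTrivial⇒n>1 _ {{prime⇒nonTrivial pp}}

  prime∣prime⇒≡ : ∀ {p q} → Prime p → Prime q → p ∣ q → p ≡ q
  prime∣prime⇒≡ pp pq p∣q with prime⇒irreducible pq p∣q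
  ... | inj₁ refl = ⊥-elim (<-irrefl refl (prime>1 pp))
  ... | inj₂ p≡q  = p≡q

  prime-divisor : ∀ m → 1 < m → ∃ λ p → Prime p × p ∣ m
  prime-divisor m@(suc _) 1<m = head factors isFactorisation factorsPrime
    where
    open PrimeFactorisation (factorise m)
    head : ∀ ps → m ≡ product ps → All Prime ps → ∃ λ p → Prime p × p ∣ m
    head []       m≡1 _        = ⊥-elim (<⇒≢ 1<m (sym m≡1))
    head (p ∷ ps) m≡  (pp ∷ _) = p , pp , subst (p ∣_) (sym m≡) (m∣m*n (product ps))

  primesUpTo : ℕ → List ℕ
  primesUpTo m = filter prime? (upTo (suc m))

  ∈-primesUpTo⁺ : ∀ {p m} → Prime p → p ≤ m → p ∈ primesUpTo m
  ∈-primesUpTo⁺ pp p≤m = ∈ₚ.∈-filter⁺ prime? (∈ₚ.∈-upTo⁺ (s≤s p≤m)) pp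

  ∈-primesUpTo⁻ : ∀ m {p} → p ∈ primesUpTo m → Prime p × p ≤ m
  ∈-primesUpTo⁻ m p∈ with ∈ₚ.∈-filter⁻ prime? {xs = upTo (suc m)} p∈
  ... | p∈upTo , pp = pp , ≤-pred (∈ₚ.∈-upTo⁻ p∈upTo)

  label≤n : ∀ {n} (v : Fin (n ∸ 1)) → label v ≤ n
  label≤n {suc n} v = s≤s (Finₚ.toℕ<n v)

  module _ (n : ℕ) where

    open SimpleGraph (gcdGraph n)

    private
      V : Set
      V = Fin (n ∸ 1)

      vertex : ∀ {m} → 1 < m → m ≤ n → ∃ λ (v : V) → label v ≡ m
      vertex {suc zero} (s≤s ())
      vertex {suc (suc m)} _ m≤n = fromℕ< m<n∸1 , cong (2 +_) (Finₚ.toℕ-fromℕ< m<n∸1)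
        where m<n∸1 = ∸-monoˡ-≤ 1 m≤n

      1<label : ∀ (v : V) → 1 < label v
      1<label v = s≤s (s≤s z≤n)

      label-injective : ∀ {u v : V} → label u ≡ label v → u ≡ v
      label-injective eq = Finₚ.toℕ-injective (suc-injective (suc-injective eq))

      gcd>1 : ∀ {d} (u v : V) → 1 < d → d ∣ label u → d ∣ label v → 1 < gcd (label u) (label v)
      gcd>1 u v 1<d d∣u d∣v = <-≤-trans 1<d
        (∣⇒≤ {{≢-nonZero (gcd[m,n]≢0 (label u) (label v) (inj₁ λ ()))}} (gcd-greatest d∣u d∣v))

      primeOf : V → ℕ
      primeOf v = proj₁ (prime-divisor (label v) (1<label v))

      primeOf-prime : ∀ v → Prime (primeOf v)
      primeOf-prime v = proj₁ (proj₂ (prime-divisor (label v) (1<label v)))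

      primeOf-∣ : ∀ v → primeOf v ∣ label v
      primeOf-∣ v = proj₂ (proj₂ (prime-divisor (label v) (1<label v)))

      -- Says that `label v` is a power of `p`, phrased through its prime divisors so that no
      -- exponent has to be carried along.
      PrimaryAt : ℕ → V → Set
      PrimaryAt p v = Prime p × p ∣ label v × (∀ {q} → Prime q → q ∣ label v → q ≡ p)

      -- Distinct primes p, q ∣ label v would be non-adjacent neighbours of v.
      simplicial⇒primary : ∀ {v} → Simplicial v → PrimaryAt (primeOf v) v
      simplicial⇒primary {v} simp = primeOf-prime v , primeOf-∣ v , λ pq q∣v →
        [ (λ q≡p → q≡p) , (λ q≢p → ⊥-elim (absurd pq q∣v (primeOf-prime v) (primeOf-∣ v) q≢p)) ]′ (≡⊎≢ _ _)
        where
        ≡⊎≢ : ∀ q p → q ≡ p ⊎ q ≢ p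
        ≡⊎≢ q p with q ≟ p
        ... | yes eq = inj₁ eq
        ... | no neq = inj₂ neq
        absurd : ∀ {q p} → Prime q → q ∣ label v → Prime p → p ∣ label v → ¬ q ≢ p
        absurd {q} {p} pq q∣v pp p∣v q≢p
          with vertex (prime>1 pq) (≤-trans (∣⇒≤ q∣v) (label≤n v)) | vertex (prime>1 pp) (≤-trans (∣⇒≤ p∣v) (label≤n v))
        -- Simpliciality at `v` makes the vertices `q` and `p` adjacent, so some prime divides both,
        -- and it must equal each of them.
        ... | x , refl | y , refl = conclude (proj₂ (simp x y (neighbour pq q∣v pp p∣v q≢p)
                                                              (neighbour pp p∣v pq q∣v (q≢p ∘ sym)) λ { refl → q≢p refl }))
          where
          neighbour : ∀ {x y} → Prime (label x) → label x ∣ label v → Prime (label y) → label y ∣ label v →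
                      label x ≢ label y → Adj v x
          -- `x` is not `v` itself, since otherwise the prime `label y` would divide the different
          -- prime `label x`.
          neighbour {x} px x∣v py y∣v x≢y =
            (λ { refl → x≢y (sym (prime∣prime⇒≡ py px y∣v)) }) , gcd>1 v x (prime>1 px) x∣v ∣-refl
          conclude : ¬ 1 < gcd (label x) (label y)
          conclude 1<g with prime-divisor _ 1<g
          ... | r , pr , r∣g = q≢p (trans (sym (prime∣prime⇒≡ pr pq (∣-trans r∣g (gcd[m,n]∣m (label x) (label y)))))
                                          (prime∣prime⇒≡ pr pp (∣-trans r∣g (gcd[m,n]∣n (label x) (label y)))))

      adj⇒∣ : ∀ {p v x} → PrimaryAt p v → Adj v x → p ∣ label x
      adj⇒∣ {p} {v} {x} (_ , _ , unique) (_ , 1<g) with prime-divisor _ 1<g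
      ... | r , pr , r∣g = subst (_∣ label x) (unique pr (∣-trans r∣g (gcd[m,n]∣m (label v) (label x))))
                             (∣-trans r∣g (gcd[m,n]∣n (label v) (label x)))

      ∈N⇒∣ : ∀ {p v x} → PrimaryAt p v → x ∈N[ v ] → p ∣ label x
      ∈N⇒∣ (_ , p∣v , _) (inj₁ refl) = p∣v
      ∈N⇒∣ prim          (inj₂ adj)  = adj⇒∣ prim adj

      ∣⇒∈N : ∀ {p v x} → PrimaryAt p v → p ∣ label x → x ∈N[ v ]
      ∣⇒∈N {v = v} {x} (pp , p∣v , _) p∣x with x Finₚ.≟ v
      ... | yes x≡v = inj₁ x≡v
      ... | no  x≢v = inj₂ (x≢v ∘ sym , gcd>1 v x (prime>1 pp) p∣v p∣x)

      primary⇒simplicial : ∀ {p v} → PrimaryAt p v → Simplicial v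
      primary⇒simplicial prim x y vx vy x≢y =
        x≢y , gcd>1 x y (prime>1 (proj₁ prim)) (adj⇒∣ prim vx) (adj⇒∣ prim vy)

      -- Both closed neighbourhoods are the set of multiples of `p`. Together with `twins⇒≡` this
      -- matches classes of simplicial vertices with primes.
      primary⇒twins : ∀ {p u v} → PrimaryAt p u → PrimaryAt p v → TrueTwins u v
      primary⇒twins prim-u prim-v x =
        mk⇔ (∣⇒∈N prim-v ∘ ∈N⇒∣ prim-u) (∣⇒∈N prim-u ∘ ∈N⇒∣ prim-v)

      -- `u` lies in its own closed neighbourhood, hence in that of `v`; so `q` divides `label u`,
      -- whose only prime divisor is `p`.
      twins⇒≡ : ∀ {p q u v} → PrimaryAt p u → PrimaryAt q v → TrueTwins u v → p ≡ q
      twins⇒≡ {u = u} (_ , _ , unique) prim-v twins =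
        sym (unique (proj₁ prim-v) (∈N⇒∣ prim-v (Equivalence.to (twins u) (inj₁ refl))))

      closedNeighbourhood : V → List V
      closedNeighbourhood v = v ∷ filter (adj? v) (allFin (n ∸ 1))

      closedNeighbourhood! : ∀ v → Unique (closedNeighbourhood v)
      closedNeighbourhood! v =
        All.tabulate (λ {x} x∈ v≡x → adj-irrefl v≡x (proj₂ (∈ₚ.∈-filter⁻ (adj? v) {xs = allFin (n ∸ 1)} x∈)))
        ∷ Uniqueₚ.filter⁺ (adj? v) (Uniqueₚ.allFin⁺ (n ∸ 1))

      -- The `suc` accounts for `v` itself. The labels in the closed neighbourhood are p, 2p, ...,
      -- (n / p) p, indexed below from 0 by `suc i * p`.
      suc-degree : ∀ {p v} → PrimaryAt p v → .{{_ : NonZero p}} → suc (degree v) ≡ n / p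
      suc-degree {p} {v} prim = trans (sym (length-map label (closedNeighbourhood v)))
        (trans (unique∧set⇒length (Uniqueₚ.map⁺ label-injective (closedNeighbourhood! v)) multiples! to from)
          (trans (length-map (λ i → suc i * p) (upTo (n / p))) (length-upTo (n / p))))
        where
        multiples : List ℕ
        multiples = map (λ i → suc i * p) (upTo (n / p))
        multiples! : Unique multiples
        multiples! = Uniqueₚ.map⁺ (λ {i} {j} eq → suc-injective (*-cancelʳ-≡ (suc i) (suc j) p eq)) (Uniqueₚ.upTo⁺ (n / p))
        ∈N : ∀ {x} → x ∈ closedNeighbourhood v → x ∈N[ v ]
        ∈N (here x≡v) = inj₁ x≡v
        ∈N (there x∈) = inj₂ (proj₂ (∈ₚ.∈-filter⁻ (adj? v) {xs = allFin (n ∸ 1)} x∈))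
        N∈ : ∀ {x} → x ∈N[ v ] → x ∈ closedNeighbourhood v
        N∈ (inj₁ x≡v) = here x≡v
        N∈ (inj₂ adj) = there (∈ₚ.∈-filter⁺ (adj? v) (∈ₚ.∈-allFin _) adj)
        to : ∀ {z} → z ∈ map label (closedNeighbourhood v) → z ∈ multiples
        to z∈ with ∈ₚ.∈-map⁻ label z∈
        ... | x , x∈ , refl with ∈N⇒∣ prim (∈N x∈)
        ...   | divides (suc i) eq = subst (_∈ multiples) (sym eq) (∈ₚ.∈-map⁺ (λ i → suc i * p)
                  (∈ₚ.∈-upTo⁺ (*≤⇒≤/ {suc i} n p (subst (_≤ n) eq (label≤n x)))))
        from : ∀ {z} → z ∈ multiples → z ∈ map label (closedNeighbourhood v)
        from z∈ with ∈ₚ.∈-map⁻ (λ i → suc i * p) z∈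
        ... | i , i∈ , refl with vertex {suc i * p} (<-≤-trans (prime>1 (proj₁ prim)) (m≤m+n p (i * p)))
                                        (≤/⇒*≤ {suc i} n p (∈ₚ.∈-upTo⁻ {n / p} {i} i∈))
        ...   | x , eq = subst (_∈ map label (closedNeighbourhood v)) eq
                  (∈ₚ.∈-map⁺ label (N∈ (∣⇒∈N prim (divides (suc i) eq))))

    -- A class of simplicial vertices with common degree k − 1 consists of the powers of one prime p with n / p = k.
    s+π≡π : ∀ k → s (suc k) + length (primesUpTo (n / suc (suc k))) ≡ length (primesUpTo (n / suc k))
    -- The primes of the classes and the primes up to n / (k + 1) are disjoint and together make up
    -- the primes up to n / k. Counting a union avoids truncated subtraction.
    s+π≡π k′ = trans (cong (_+ length larger) (sym (length-map primeOf classes)))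
      (trans (sym (length-++ (map primeOf classes)))
        (unique∧set⇒length (Uniqueₚ.++⁺ classPrimes! (primesUpTo! (n / suc k)) disjoint) (primesUpTo! (n / k)) to from))
      where
      k : ℕ
      k = suc k′
      P? = λ v → simplicial? v ×-dec (suc (degree v) ≟ k)
      candidates classes : List V
      candidates = filter P? (allFin (n ∸ 1))
      classes = deduplicate trueTwins? candidates
      larger : List ℕ
      larger = primesUpTo (n / suc k)
      primesUpTo! : ∀ m → Unique (primesUpTo m)
      primesUpTo! m = Uniqueₚ.filter⁺ prime? (Uniqueₚ.upTo⁺ (suc m))
      candidate⁻ : ∀ {v} → v ∈ candidates → Simplicial v × suc (degree v) ≡ k
      candidate⁻ v∈ = proj₂ (∈ₚ.∈-filter⁻ P? {xs = allFin (n ∸ 1)} v∈)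
      class⁻ : ∀ {v} → v ∈ classes → Simplicial v × suc (degree v) ≡ k
      class⁻ v∈ = candidate⁻ (∈ₚ.∈-deduplicate⁻ trueTwins? candidates v∈)
      classPrimes! : Unique (map primeOf classes)
      classPrimes! = AllPairsₚ.map⁺ (AllPairs-map-All {P = Simplicial}
        (λ {u} {v} su sv ¬twins eq → ¬twins (primary⇒twins (simplicial⇒primary su)
          (subst (λ p → PrimaryAt p v) (sym eq) (simplicial⇒primary sv))))
        (All.tabulate (proj₁ ∘ class⁻)) (deduplicate-pairwise trueTwins? candidates))
      quotient : ∀ {v} → v ∈ classes → let instance nz = prime⇒nonZero (primeOf-prime v) in n / primeOf v ≡ k
      quotient {v} v∈ = trans (sym (suc-degree (simplicial⇒primary (proj₁ (class⁻ v∈))) {{prime⇒nonZero (primeOf-prime v)}}))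
                              (proj₂ (class⁻ v∈))
      classPrime⁻ : ∀ {z} → z ∈ map primeOf classes → ∃ λ (pz : Prime z) → (n / z) {{prime⇒nonZero pz}} ≡ k
      classPrime⁻ z∈ = let v , v∈ , z≡ = ∈ₚ.∈-map⁻ primeOf z∈ in
        subst (λ z → ∃ λ (pz : Prime z) → (n / z) {{prime⇒nonZero pz}} ≡ k) (sym z≡) (primeOf-prime v , quotient v∈)
      disjoint : ∀ {z} → ¬ (z ∈ map primeOf classes × z ∈ larger)
      disjoint {z} (z∈ , z∈larger) = let pz , n/z≡k = classPrime⁻ z∈ in
        <-irrefl refl (≤-trans (*≤⇒≤/ n z {{prime⇒nonZero pz}} (subst (_≤ n) (*-comm z (suc k))
          (≤/⇒*≤ n (suc k) (proj₂ (∈-primesUpTo⁻ (n / suc k) z∈larger))))) (≤-reflexive n/z≡k))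
      to : ∀ {z} → z ∈ map primeOf classes ++ larger → z ∈ primesUpTo (n / k)
      to {z} z∈ = [ fromClass , fromLarger ]′ (∈ₚ.∈-++⁻ (map primeOf classes) z∈)
        where
        fromClass : z ∈ map primeOf classes → z ∈ primesUpTo (n / k)
        fromClass z∈ = let pz , n/z≡k = classPrime⁻ z∈ in
          ∈-primesUpTo⁺ pz (*≤⇒≤/ n k (subst (_≤ n) (*-comm k z)
            (≤/⇒*≤ n z {{prime⇒nonZero pz}} (≤-reflexive (sym n/z≡k)))))
        fromLarger : z ∈ larger → z ∈ primesUpTo (n / k)
        fromLarger z∈ = let pz , z≤ = ∈-primesUpTo⁻ (n / suc k) z∈ in
          ∈-primesUpTo⁺ pz (≤-trans z≤ (/-monoʳ-≤ n (n≤1+n k)))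
      from : ∀ {z} → z ∈ primesUpTo (n / k) → z ∈ map primeOf classes ++ larger
      -- From z ≤ n / k follows n / z ≥ k. Equality puts `z` among the class primes; a larger
      -- quotient means z ≤ n / (k + 1).
      from {z} z∈ = [ inClasses , inLarger ]′ (≤-<-connex (n / z) k)
        where
        pz : Prime z
        pz = proj₁ (∈-primesUpTo⁻ (n / k) z∈)
        z≤ : z ≤ n / k
        z≤ = proj₂ (∈-primesUpTo⁻ (n / k) z∈)
        instance nz = prime⇒nonZero pz
        inLarger : k < n / z → z ∈ map primeOf classes ++ larger
        inLarger k<n/z = ∈ₚ.∈-++⁺ʳ (map primeOf classes) (∈-primesUpTo⁺ pz (*≤⇒≤/ n (suc k)
          (subst (_≤ n) (*-comm (suc k) z) (≤/⇒*≤ n z k<n/z))))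
        n/z≥k : k ≤ n / z
        n/z≥k = *≤⇒≤/ n z (subst (_≤ n) (*-comm z k) (≤/⇒*≤ n k z≤))
        z≤N : z ≤ n
        z≤N = ≤-trans z≤ (≤-trans (/-monoʳ-≤ n (s≤s z≤n)) (≤-reflexive (n/1≡n n)))
        -- The vertex labelled by the prime itself witnesses that its class is nonempty.
        v : V
        v = proj₁ (vertex (prime>1 pz) z≤N)
        label-v : label v ≡ z
        label-v = proj₂ (vertex (prime>1 pz) z≤N)
        primary : PrimaryAt z v
        primary = pz , subst (z ∣_) (sym label-v) ∣-refl ,
                  λ pq q∣v → prime∣prime⇒≡ pq pz (subst (_ ∣_) label-v q∣v)
        inClasses : n / z ≤ k → z ∈ map primeOf classes ++ larger
        inClasses n/z≤k = ∈ₚ.∈-++⁺ˡ (subst (_∈ map primeOf classes)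
          (sym (twins⇒≡ primary (simplicial⇒primary (proj₁ (class⁻ u∈))) twins)) (∈ₚ.∈-map⁺ primeOf u∈))
          where
          v∈ : v ∈ candidates
          v∈ = ∈ₚ.∈-filter⁺ P? (∈ₚ.∈-allFin v)
                 (primary⇒simplicial primary , trans (suc-degree primary) (≤-antisym n/z≤k n/z≥k))
          representative : ∃ λ u → u ∈ classes × TrueTwins v u
          -- `deduplicate` may have kept a different power of `z` in place of `v`; being a true twin
          -- of `v`, it has the same prime.
          representative = find (Anyₚ.deduplicate⁺ trueTwins? (λ {x} {y} yx vx w →
            mk⇔ (Equivalence.from (yx w) ∘ Equivalence.to (vx w)) (Equivalence.from (vx w) ∘ Equivalence.to (yx w)))
            (Any.map (λ { refl w → mk⇔ (λ i → i) (λ i → i) }) v∈))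
          u = proj₁ representative
          u∈ = proj₁ (proj₂ representative)
          twins = proj₂ (proj₂ representative)

-- From prime counts to Dirichlet transforms of π - Li

module PrimeCounting (em : ExcludedMiddle 0ℓ) (R : CompleteOrderedField) where

  open Sums em R public
  open SimplicialClasses

  -- The floor function

  IsFloor : ℝ → ℕ → Set
  IsFloor x n = fromℕ n ≤ x × x < fromℕ (suc n)

  floor-exists : ∀ {x} → 0# ≤ x → ∃ (IsFloor x)
  floor-exists {x} 0≤x = below (proj₁ (archimedean x)) (proj₂ (archimedean x))
    where
    below : ∀ n → x < fromℕ n → ∃ (IsFloor x)
    below zero    x<0   = ⊥-elim (<⇒≱ x<0 0≤x)
    below (suc n) x<1+n = [ (λ n≤x → n , n≤x , x<1+n) , below n ]′ (≤-or-> (fromℕ n) x)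

  ⌊⌋-isFloor : ∀ {x} → 0# ≤ x → IsFloor x ⌊ x ⌋
  ⌊⌋-isFloor {x} 0≤x with em {∃ λ n → fromℕ n ≤ x × x < fromℕ (suc n)}
  ... | yes (_ , spec) = spec
  ... | no  none       = ⊥-elim (none (floor-exists 0≤x))

  ⌊⌋-unique : ∀ {x n} → IsFloor x n → ⌊ x ⌋ ≡ n
  ⌊⌋-unique {x} {n} (n≤x , x<1+n) = ℕₚ.≤-antisym
    (ℕₚ.≤-pred (fromℕ-cancel-< (≤-<-trans (proj₁ floor) x<1+n)))
    (ℕₚ.≤-pred (fromℕ-cancel-< (≤-<-trans n≤x (proj₂ floor))))
    where floor = ⌊⌋-isFloor (≤-trans (0≤fromℕ n) n≤x)

  -- Bridges the graph side, which counts primes up to integer quotients of ⌊x⌋, and the values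
  -- π(x/k) at real arguments.
  ⌊x/k⌋≡⌊x⌋/k : ∀ {x} k → 0# ≤ x → ⌊ x / fromℕ (suc k) ⌋ ≡ ⌊ x ⌋ ℕ./ suc k
  ⌊x/k⌋≡⌊x⌋/k {x} k 0≤x = ⌊⌋-unique (y*z≤x⇒y≤x/z 0<k lower , ≰⇒> λ le → <⇒≱ upper (begin
      fromℕ (suc q) * fromℕ (suc k)              ≤⟨ *-monoˡ-≤ (<⇒≤ 0<k) le ⟩
      x / fromℕ (suc k) * fromℕ (suc k)          ≡⟨ x/y*y≡x x 0<k ⟩
      x                                          ∎))
    where
    n q : ℕ
    n = ⌊ x ⌋
    q = n ℕ./ suc k
    0<k : 0# < fromℕ (suc k)
    0<k = fromℕ-pos {suc k} (s≤s z≤n)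
    lower : fromℕ q * fromℕ (suc k) ≤ x
    lower = begin
      fromℕ q * fromℕ (suc k)    ≡⟨ fromℕ-* q (suc k) ⟨
      fromℕ (q ℕ.* suc k)        ≤⟨ fromℕ-mono-≤ (≤/⇒*≤ n (suc k) ℕₚ.≤-refl) ⟩
      fromℕ n                    ≤⟨ proj₁ (⌊⌋-isFloor 0≤x) ⟩
      x                          ∎
    upper : x < fromℕ (suc q) * fromℕ (suc k)
    upper = <-≤-trans (proj₂ (⌊⌋-isFloor 0≤x)) (≤-trans
      (fromℕ-mono-≤ (ℕₚ.≰⇒> λ le → ℕₚ.<-irrefl refl (*≤⇒≤/ {suc q} n (suc k) le)))
      (reflexive (fromℕ-* (suc q) (suc k))))

  -- The error term π − Li

  Δ : ℝ → ℝ
  Δ x = fromℕ (π x) - Li x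

  Li-vanish : ∀ {x} → x < 2# → Li x ≡ 0#
  Li-vanish {x} x<2 with em {2# ≤ x}
  ... | yes 2≤x = ⊥-elim (<⇒≱ x<2 2≤x)
  ... | no  _   = refl

  π-vanish : ∀ {x} → 0# ≤ x → x < 2# → π x ≡ 0
  π-vanish {x} 0≤x x<2 = small ⌊ x ⌋ (fromℕ-cancel-< (≤-<-trans (proj₁ (⌊⌋-isFloor 0≤x)) x<2))
    where
    small : ∀ n → n ℕ.< 2 → length (primesUpTo n) ≡ 0
    small 0             _                = refl
    small 1             _                = refl
    small (suc (suc _)) (s≤s (s≤s ()))

  VanishesBelow2 : (ℝ → ℝ) → Set
  VanishesBelow2 F = ∀ {x} → 0# < x → x < 2# → F x ≡ 0#

  Δ-vanish : VanishesBelow2 Δ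
  Δ-vanish 0<x x<2 = trans (cong₂ (λ p l → fromℕ p - l) (π-vanish (<⇒≤ 0<x) x<2) (Li-vanish x<2)) (-‿inverseʳ 0#)

  x/k-small : ∀ {x N k} → x < fromℕ (suc N) → N ℕ.< k → x / fromℕ k < 2#
  x/k-small {x} {N} {k} x<1+N N<k = ≰⇒> λ 2≤ → <⇒≱ (<-≤-trans x<1+N (fromℕ-mono-≤ N<k)) (begin
    fromℕ k                    ≡⟨ *-identityˡ _ ⟨
    1# * fromℕ k               ≤⟨ *-monoˡ-≤ (0≤fromℕ k) (≤-trans (<⇒≤ 1<2) 2≤) ⟩
    x / fromℕ k * fromℕ k      ≡⟨ x/y*y≡x x (fromℕ-pos (ℕₚ.≤-trans (s≤s z≤n) N<k)) ⟩
    x                          ∎)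

  x/k-pos : ∀ {x k} → 0# < x → 1 ℕ.≤ k → 0# < x / fromℕ k
  x/k-pos 0<x 1≤k = /-pos 0<x (fromℕ-pos 1≤k)

  x/k≤x : ∀ {x k} → 0# ≤ x → 1 ℕ.≤ k → x / fromℕ k ≤ x
  x/k≤x {x} {k} 0≤x 1≤k = x≤y*z⇒x/z≤y (fromℕ-pos 1≤k)
    (subst (_≤ x * fromℕ k) (*-identityʳ x) (*-monoʳ-≤ 0≤x (1≤fromℕ 1≤k)))

  -- 𝒯 − ℳ as a finite sum

  sℝ : ℝ → ℕ → ℝ
  sℝ x k = fromℕ (SimpleGraph.s (gcdGraph ⌊ x ⌋) k)

  sℝ≡π-π : ∀ {x} k → 0# ≤ x → 1 ℕ.≤ k →
           sℝ x k ≡ fromℕ (π (x / fromℕ k)) - fromℕ (π (x / fromℕ (suc k)))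
  sℝ≡π-π {x} (suc k) 0≤x _ = trans (sym (x+z-z≡x _ (fromℕ (π (x / fromℕ (suc (suc k)))))))
    (cong (_- fromℕ (π (x / fromℕ (suc (suc k))))) (trans (sym (fromℕ-+ (SimpleGraph.s (gcdGraph ⌊ x ⌋) (suc k)) (π (x / fromℕ (suc (suc k))))))
      (cong fromℕ (trans (cong (λ m → SimpleGraph.s (gcdGraph ⌊ x ⌋) (suc k) ℕ.+ length (primesUpTo m)) (⌊x/k⌋≡⌊x⌋/k (suc k) 0≤x))
        (trans (s+π≡π ⌊ x ⌋ k) (cong (λ m → length (primesUpTo m)) (sym (⌊x/k⌋≡⌊x⌋/k k 0≤x))))))))

  -- Summation by parts with the boundary term kept on the left; in the application it is a value of
  -- π - Li below 2 and disappears. The base case is the convention a₁ = w₁.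
  abel : ∀ w (H : Seq) N → ∑ (suc N) (λ k → w k * (H k - H (suc k))) + w (suc N) * H (suc (suc N)) ≡
         ∑ (suc N) (λ k → differences w k * H k)
  abel w H zero = solve 3 (λ w h h′ → :0 :+ w :* (h :- h′) :+ w :* h′ := :0 :+ w :* h) refl (w 1) (H 1) (H 2)
  abel w H (suc N) = trans
    (solve 6 (λ s w w′ h h′ h″ → s :+ w′ :* (h′ :- h″) :+ w′ :* h″ := (s :+ w :* h′) :+ (w′ :- w) :* h′) refl
      (∑ (suc N) (λ k → w k * (H k - H (suc k)))) (w (suc N)) (w (suc (suc N)))
      (H (suc N)) (H (suc (suc N))) (H (suc (suc (suc N)))))
    (cong (_+ (w (suc (suc N)) - w (suc N)) * H (suc (suc N))) (abel w H N))

  -- For k > N + 1 the point x/k lies below 2, so both series have finite support and Abel summation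
  -- leaves no boundary term.
  𝒯-ℳ≡∑ : ∀ w {x} N → 0# < x → x < fromℕ (suc (suc N)) →
          𝒯 w x - ℳ w x ≡ ∑ (suc N) (λ k → differences w k * Δ (x / fromℕ k))
  𝒯-ℳ≡∑ w {x} N 0<x x<2+N = begin-equality
    𝒯 w x - ℳ w x
      ≡⟨ cong₂ _-_ (HasSum⇒∑∞ (HasSum-finite (suc N) 𝒯-vanish)) (HasSum⇒∑∞ (HasSum-finite (suc N) ℳ-vanish)) ⟩
    ∑ (suc N) t - ∑ (suc N) l
      ≡⟨ solve 2 (λ s t → s :- t := s :+ (:- :1) :* t) refl (∑ (suc N) t) (∑ (suc N) l) ⟩
    ∑ (suc N) t + (- 1#) * ∑ (suc N) l
      ≡⟨ cong (∑ (suc N) t +_) (∑-*ˡ (suc N) (- 1#) l) ⟨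
    ∑ (suc N) t + ∑ (suc N) (λ k → (- 1#) * l k)
      ≡⟨ ∑-+ (suc N) t (λ k → (- 1#) * l k) ⟨
    ∑ (suc N) (λ k → t k + (- 1#) * l k)
      ≡⟨ ∑-cong (suc N) (λ k 1≤k _ → combine k 1≤k) ⟩
    ∑ (suc N) (λ k → w k * (H k - H (suc k)))
      ≡⟨ trans (cong (∑ (suc N) (λ k → w k * (H k - H (suc k))) +_) last≡0) (+-identityʳ _) ⟨
    ∑ (suc N) (λ k → w k * (H k - H (suc k))) + w (suc N) * H (suc (suc N))
      ≡⟨ abel w H N ⟩
    ∑ (suc N) (λ k → differences w k * H k)
      ∎
    where
    H t l : Seq
    H k = Δ (x / fromℕ k)
    t k = w k * sℝ x k
    l k = w k * (Li (x / fromℕ k) - Li (x / fromℕ (suc k)))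
    1≤ : ∀ {k} → suc N ℕ.< k → 1 ℕ.≤ k
    1≤ = ℕₚ.≤-trans (s≤s z≤n)
    π≡0 : ∀ k → suc N ℕ.< k → fromℕ (π (x / fromℕ k)) ≡ 0#
    π≡0 k N<k = cong fromℕ (π-vanish (<⇒≤ (x/k-pos 0<x (1≤ N<k))) (x/k-small x<2+N N<k))
    𝒯-vanish : ∀ k → suc N ℕ.< k → t k ≡ 0#
    𝒯-vanish k N<k = trans (cong (w k *_) (trans (sℝ≡π-π k (<⇒≤ 0<x) (1≤ N<k))
      (trans (cong₂ _-_ (π≡0 k N<k) (π≡0 (suc k) (ℕₚ.m<n⇒m<1+n N<k))) (-‿inverseʳ 0#)))) (zeroʳ _)
    ℳ-vanish : ∀ k → suc N ℕ.< k → l k ≡ 0#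
    ℳ-vanish k N<k = trans (cong (w k *_) (trans (cong₂ _-_ (Li-vanish (x/k-small x<2+N N<k))
      (Li-vanish (x/k-small x<2+N (ℕₚ.m<n⇒m<1+n N<k)))) (-‿inverseʳ 0#))) (zeroʳ _)
    last≡0 : w (suc N) * H (suc (suc N)) ≡ 0#
    last≡0 = trans (cong (w (suc N) *_) (Δ-vanish (x/k-pos {k = suc (suc N)} 0<x (s≤s z≤n)) (x/k-small {N = suc N} x<2+N ℕₚ.≤-refl))) (zeroʳ _)
    combine : ∀ k → 1 ℕ.≤ k → t k + (- 1#) * l k ≡ w k * (H k - H (suc k))
    combine k 1≤k = trans (cong (λ z → w k * z + (- 1#) * l k) (sℝ≡π-π k (<⇒≤ 0<x) 1≤k))
      (solve 5 (λ w p p′ l l′ → w :* (p :- p′) :+ (:- :1) :* (w :* (l :- l′)) := w :* ((p :- l) :- (p′ :- l′))) refl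
        (w k) (fromℕ (π (x / fromℕ k))) (fromℕ (π (x / fromℕ (suc k)))) (Li (x / fromℕ k)) (Li (x / fromℕ (suc k))))

  -- Dirichlet inversion

  -- The sum of c_k F(x/k) over all k, as it reads for `F` vanishing below 2. Asking for the
  -- equation at every admissible cut-off allows sums at different points to be given equal length.
  _DirichletTransformOf_by_ : (ℝ → ℝ) → (ℝ → ℝ) → Seq → Set
  G DirichletTransformOf F by c = ∀ {x} N → 0# < x → x < fromℕ (suc (suc N)) →
                                  G x ≡ ∑ (suc N) (λ k → c k * F (x / fromℕ k))

  -- For x < 2 the cut-off N = 0 is admissible and leaves only the term k = 1.
  transform-vanish : ∀ {F G c} → VanishesBelow2 F → G DirichletTransformOf F by c → VanishesBelow2 G
  transform-vanish {F} {G} {c} F-vanish G≡ {x} 0<x x<2 = trans (G≡ 0 0<x x<2) (trans (+-identityˡ _)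
    (trans (cong (c 1 *_) (F-vanish (x/k-pos {k = 1} 0<x (s≤s z≤n))
      (≤-<-trans (x/k≤x {k = 1} (<⇒≤ 0<x) (s≤s z≤n)) x<2))) (zeroʳ _)))

  inversion : ∀ {F G a b} → VanishesBelow2 F → IsDirichletInverse a b →
              G DirichletTransformOf F by a → F DirichletTransformOf G by b
  inversion {F} {G} {a} {b} F-vanish a∗b≡unit G≡ {x} N′ 0<x x<1+N = sym (begin-equality
    ∑ N (λ j → b j * G (x / fromℕ j))
      -- As x/j ≤ x, the outer cut-off is admissible for the inner sum as well, and the double sum
      -- ranges over a square.
      ≡⟨ ∑-cong N (λ j 1≤j _ → trans (cong (b j *_) (G≡ N′ (x/k-pos 0<x 1≤j)
           (≤-<-trans (x/k≤x (<⇒≤ 0<x) 1≤j) x<1+N))) (sym (∑-*ˡ N (b j) _))) ⟩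
    ∑ N (λ j → ∑ N (λ i → b j * (a i * F (x / fromℕ j / fromℕ i))))
      ≡⟨ ∑-cong N (λ j 1≤j _ → ∑-cong N λ i 1≤i _ → trans
           (solve 3 (λ b a f → b :* (a :* f) := a :* b :* f) refl (b j) (a i) (F (x / fromℕ j / fromℕ i)))
           (cong (λ y → a i * b j * F y) (x/j/i j i 1≤j 1≤i))) ⟩
    ∑ N (λ j → ∑ N (λ i → a i * b j * h (i ℕ.* j)))
      ≡⟨ ∑-swap N N _ ⟩
    ∑ N (λ i → ∑ N (λ j → a i * b j * h (i ℕ.* j)))
      -- Pairs with i j > N lie in the square but contribute 0 by `h-vanish`.
      ≡⟨ ∑-∗-reindex a b N h h-vanish ⟨
    ∑ N (λ n → (a ∗ b) n * h n)
      ≡⟨ ∑-cong N (λ n 1≤n _ → cong (_* h n) (trans (a∗b≡unit n 1≤n) (unit≡δ n 1≤n))) ⟩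
    ∑ N (λ n → δ 1 n * h n)
      ≡⟨ ∑-δ N h ℕₚ.≤-refl (s≤s z≤n) ⟩
    F (x / fromℕ 1)
      ≡⟨ cong F (trans (cong (x /_) fromℕ-1) (x/1≡x x)) ⟩
    F x
      ∎)
    where
    N : ℕ
    N = suc N′
    h : Seq
    h n = F (x / fromℕ n)
    h-vanish : ∀ n → N ℕ.< n → h n ≡ 0#
    h-vanish n N<n = F-vanish (x/k-pos 0<x (ℕₚ.≤-trans (s≤s z≤n) N<n)) (x/k-small x<1+N N<n)
    x/j/i : ∀ j i → 1 ℕ.≤ j → 1 ℕ.≤ i → x / fromℕ j / fromℕ i ≡ x / fromℕ (i ℕ.* j)
    x/j/i j i 1≤j 1≤i = trans (x/y/z≡x/[y*z] x (fromℕ-pos 1≤j) (fromℕ-pos 1≤i))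
      (cong (x /_) (trans (*-comm _ _) (sym (fromℕ-* i j))))
    unit≡δ : ∀ n → 1 ℕ.≤ n → unit n ≡ δ 1 n
    unit≡δ 1             _ = sym (δ-≡ {1} refl)
    unit≡δ (suc (suc n)) _ = sym (δ-≢ {1} {suc (suc n)} λ ())

  -- Transfer of error bounds

  ν : ℝ → ℕ → ℝ
  ν θ j = fromℕ j ^ (- θ)

  errorBound : ℝ → ℝ → ℝ → ℝ
  errorBound θ m x = x ^ θ * log (e * x) ^ m

  0<e*x : ∀ {x} → 0# < x → 0# < e * x
  0<e*x 0<x = *-pos (exp-pos 1#) 0<x

  -- The factor k^(-θ) comes exactly from the power of x; the logarithmic factor only grows when x/k
  -- is replaced by x, because m ≥ 0. The bound 2 ≤ x/k keeps its base positive.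
  errorBound-scale : ∀ {θ m x k} → 0# ≤ m → 1 ℕ.≤ k → 2# ≤ x / fromℕ k → 0# < x →
                     errorBound θ m (x / fromℕ k) ≤ ν θ k * errorBound θ m x
  errorBound-scale {θ} {m} {x} {k} 0≤m 1≤k 2≤x/k 0<x = begin
    (x / fromℕ k) ^ θ * log (e * (x / fromℕ k)) ^ m
      ≤⟨ *-monoʳ-≤ (<⇒≤ (^-pos _ _)) (^-monoˡ-≤ 0≤m (0<log[ex] (≤-trans (<⇒≤ 1<2) 2≤x/k))
           (log-mono-≤ (0<e*x (x/k-pos 0<x 1≤k)) (*-monoʳ-≤ (<⇒≤ (exp-pos 1#)) (x/k≤x (<⇒≤ 0<x) 1≤k)))) ⟩
    (x / fromℕ k) ^ θ * log (e * x) ^ m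
      ≡⟨ cong (_* log (e * x) ^ m) (trans (^-distribʳ-* θ 0<x (⁻¹-pos 0<k)) (cong (x ^ θ *_) (⁻¹-^ θ 0<k))) ⟩
    x ^ θ * ν θ k * log (e * x) ^ m
      ≡⟨ solve 3 (λ p q r → p :* q :* r := q :* (p :* r)) refl (x ^ θ) (ν θ k) (log (e * x) ^ m) ⟩
    ν θ k * errorBound θ m x
      ∎
    where
    0<k : 0# < fromℕ k
    0<k = fromℕ-pos 1≤k

  0≤∣c∣ν : ∀ θ (c : Seq) j → 0# ≤ ∣ c j ∣ * ν θ j
  0≤∣c∣ν θ c j = *-nonNeg (0≤∣x∣ (c j)) (<⇒≤ (^-pos _ _))

  transfer : ∀ {θ m F G c} → 0# ≤ m → c ∈ℓ¹ θ → VanishesBelow2 F → G DirichletTransformOf F by c →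
             F =O errorBound θ m → G =O errorBound θ m
  -- `S` is the weighted norm of `c`. The constant `C` has no prescribed sign, so its absolute value
  -- is used.
  transfer {θ} {m} {F} {G} {c} 0≤m (S , hasSum) F-vanish G≡ (C , F≤) = S * ∣ C ∣ , bound
    where
    bound : ∀ x → 2# ≤ x → ∣ G x ∣ ≤ S * ∣ C ∣ * errorBound θ m x
    bound x 2≤x = begin
      ∣ G x ∣
        ≡⟨ cong ∣_∣ (G≡ N 0<x (<-trans (proj₂ (archimedean x)) (<-trans (x<x+1 _) (x<x+1 _)))) ⟩
      ∣ ∑ (suc N) (λ k → c k * F (x / fromℕ k)) ∣
        ≤⟨ ∣∑∣≤∑∣∣ (suc N) _ ⟩
      ∑ (suc N) (λ k → ∣ c k * F (x / fromℕ k) ∣)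
        ≤⟨ ∑-mono-≤ (suc N) (λ k 1≤k _ → summand k 1≤k) ⟩
      ∑ (suc N) (λ k → ∣ c k ∣ * ν θ k * (∣ C ∣ * g))
        ≡⟨ ∑-*ʳ (suc N) (∣ C ∣ * g) _ ⟩
      ∑ (suc N) (λ k → ∣ c k ∣ * ν θ k) * (∣ C ∣ * g)
        ≤⟨ *-monoˡ-≤ (*-nonNeg (0≤∣x∣ C) 0≤g) (∑≤HasSum (0≤∣c∣ν θ c) hasSum (suc N)) ⟩
      S * (∣ C ∣ * g)
        ≡⟨ *-assoc S _ _ ⟨
      S * ∣ C ∣ * g
        ∎
      where
      N = proj₁ (archimedean x)
      0<x : 0# < x
      0<x = <-≤-trans 0<2 2≤x
      g : ℝ
      g = errorBound θ m x
      0≤g : 0# ≤ g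
      0≤g = <⇒≤ (*-pos (^-pos _ _) (^-pos _ _))
      F-bound : ∀ k → 1 ℕ.≤ k → ∣ F (x / fromℕ k) ∣ ≤ ν θ k * (∣ C ∣ * g)
      -- The assumed estimate speaks only of arguments from 2 on; below 2 the value of `F` is 0.
      F-bound k 1≤k = [ large , small ]′ (≤-or-> 2# (x / fromℕ k))
        where
        large : 2# ≤ x / fromℕ k → ∣ F (x / fromℕ k) ∣ ≤ ν θ k * (∣ C ∣ * g)
        large 2≤ = begin
          ∣ F (x / fromℕ k) ∣                    ≤⟨ F≤ _ 2≤ ⟩
          C * errorBound θ m (x / fromℕ k)       ≤⟨ *-monoˡ-≤ (<⇒≤ (*-pos (^-pos _ _) (^-pos _ _))) (x≤∣x∣ C) ⟩
          ∣ C ∣ * errorBound θ m (x / fromℕ k)   ≤⟨ *-monoʳ-≤ (0≤∣x∣ C) (errorBound-scale {θ} 0≤m 1≤k 2≤ 0<x) ⟩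
          ∣ C ∣ * (ν θ k * g)                    ≡⟨ solve 3 (λ c v g → c :* (v :* g) := v :* (c :* g)) refl ∣ C ∣ (ν θ k) g ⟩
          ν θ k * (∣ C ∣ * g)                    ∎
        small : x / fromℕ k < 2# → ∣ F (x / fromℕ k) ∣ ≤ ν θ k * (∣ C ∣ * g)
        small <2 = subst (_≤ ν θ k * (∣ C ∣ * g)) (sym (trans (cong ∣_∣ (F-vanish (x/k-pos 0<x 1≤k) <2)) ∣0∣≡0))
          (*-nonNeg (<⇒≤ (^-pos _ _)) (*-nonNeg (0≤∣x∣ C) 0≤g))
      summand : ∀ k → 1 ℕ.≤ k → ∣ c k * F (x / fromℕ k) ∣ ≤ ∣ c k ∣ * ν θ k * (∣ C ∣ * g)
      summand k 1≤k = begin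
        ∣ c k * F (x / fromℕ k) ∣        ≡⟨ ∣x*y∣≡∣x∣*∣y∣ _ _ ⟩
        ∣ c k ∣ * ∣ F (x / fromℕ k) ∣    ≤⟨ *-monoʳ-≤ (0≤∣x∣ (c k)) (F-bound k 1≤k) ⟩
        ∣ c k ∣ * (ν θ k * (∣ C ∣ * g))  ≡⟨ *-assoc _ _ _ ⟨
        ∣ c k ∣ * ν θ k * (∣ C ∣ * g)    ∎

-- Construction of the Dirichlet inverse

module DirichletInverse (em : ExcludedMiddle 0ℓ) (R : CompleteOrderedField) where

  open PrimeCounting em R public

  tail : Seq → Seq
  tail a 1 = 0#
  tail a n = a n

  -- `tail a` vanishes at 1, so only factorisations r j = n with r ≥ 2 matter, and these have j < n.
  -- Hence the recursion for the inverse is well founded.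
  ∗-tail-cong : ∀ a {d d′} n → 1 ℕ.≤ n → (∀ j → 1 ℕ.≤ j → j ℕ.< n → d j ≡ d′ j) →
                (tail a ∗ d) n ≡ (tail a ∗ d′) n
  ∗-tail-cong a {d} {d′} n 1≤n eq = trans (∗-expand (tail a) d 1≤n ℕₚ.≤-refl)
    (trans (∑-cong n λ r 1≤r _ → ∑-cong n λ j 1≤j _ → δ*-cong (summand r j 1≤r 1≤j))
      (sym (∗-expand (tail a) d′ 1≤n ℕₚ.≤-refl)))
    where
    summand : ∀ r j → 1 ℕ.≤ r → 1 ℕ.≤ j → r ℕ.* j ≡ n → tail a r * d j ≡ tail a r * d′ j
    summand 1             j _ _   _    = trans (zeroˡ _) (sym (zeroˡ _))
    summand (suc (suc r)) j _ 1≤j rj≡n = cong (a (suc (suc r)) *_) (eq j 1≤j (subst (j ℕ.<_) (trans (ℕₚ.*-comm j (suc (suc r))) rj≡n)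
      (ℕₚ.m<m*n j (suc (suc r)) {{ℕ.>-nonZero 1≤j}} (s≤s (s≤s z≤n)))))

  ∗-tail-split : ∀ a b n → 1 ℕ.≤ n → (a ∗ b) n ≡ a 1 * b n + (tail a ∗ b) n
  ∗-tail-split a b n@(suc n′) 1≤n = begin-equality
    (a ∗ b) n                                ≡⟨ trans (∗-expand a b 1≤n ℕₚ.≤-refl) (∑-head n′ (X a)) ⟩
    X a 1 + ∑ n′ (X a ∘ suc)                 ≡⟨ cong₂ _+_ (X-1 a) (∑-cong n′ λ { (suc j) _ _ → refl }) ⟩
    a 1 * b n + ∑ n′ (X (tail a) ∘ suc)      ≡⟨ cong (a 1 * b n +_) (trans (cong (_+ ∑ n′ (X (tail a) ∘ suc))
                                                  (trans (X-1 (tail a)) (zeroˡ _))) (+-identityˡ _)) ⟨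
    a 1 * b n + (X (tail a) 1 + ∑ n′ (X (tail a) ∘ suc))
                                             ≡⟨ cong (a 1 * b n +_) (trans (∗-expand (tail a) b 1≤n ℕₚ.≤-refl) (∑-head n′ (X (tail a)))) ⟨
    a 1 * b n + (tail a ∗ b) n               ∎
    where
    X : Seq → Seq
    X c r = ∑ n (λ j → δ (r ℕ.* j) n * (c r * b j))
    X-1 : ∀ c → X c 1 ≡ c 1 * b n
    X-1 c = trans (∑-cong n λ j _ _ → cong (_* (c 1 * b j)) (δ-swap j)) (∑-δ n (λ j → c 1 * b j) 1≤n ℕₚ.≤-refl)
      where
      δ-swap : ∀ j → δ (1 ℕ.* j) n ≡ δ n j
      δ-swap j with n ℕₚ.≟ j
      ... | yes refl = δ-≡ (ℕₚ.*-identityˡ n)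
      ... | no  n≢j  = δ-≢ λ 1j≡n → n≢j (trans (sym 1j≡n) (ℕₚ.*-identityˡ j))

  -- Iterating b ↦ a₁⁻¹ (unit − tail a ∗ b) fixes one further coefficient at each step.
  approximation : Seq → ℕ → Seq
  approximation a zero    n = 0#
  approximation a (suc k) n = a 1 ⁻¹ * (unit n - (tail a ∗ approximation a k) n)

  inverse : Seq → Seq
  inverse a n = approximation a n n

  -- Coefficient `n` of an iterate depends only on smaller coefficients of the preceding one, so it
  -- no longer changes from iterate `n` on.
  approximation-stable : ∀ a k l n → 1 ℕ.≤ n → n ℕ.≤ k → n ℕ.≤ l → approximation a k n ≡ approximation a l n
  approximation-stable a zero    l       (suc n) _ () _
  approximation-stable a (suc k) zero    (suc n) _ _  ()
  approximation-stable a (suc k) (suc l) n 1≤n n≤k n≤l = cong (λ z → a 1 ⁻¹ * (unit n - z))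
    (∗-tail-cong a n 1≤n λ j 1≤j j<n → approximation-stable a k l j 1≤j
      (ℕₚ.≤-pred (ℕₚ.≤-trans j<n n≤k)) (ℕₚ.≤-pred (ℕₚ.≤-trans j<n n≤l)))

  module _ {a : Seq} (a₁≢0 : a 1 ≢ 0#) where

    private
      b : Seq
      b = inverse a

    a₁*inverse : ∀ n → 1 ℕ.≤ n → a 1 * b n ≡ unit n - (tail a ∗ b) n
    a₁*inverse n@(suc n′) 1≤n = begin-equality
      a 1 * (a 1 ⁻¹ * (unit n - (tail a ∗ approximation a n′) n))
        ≡⟨ trans (sym (*-assoc _ _ _)) (trans (cong (_* (unit n - (tail a ∗ approximation a n′) n)) (⁻¹-inverseʳ (a 1) a₁≢0)) (*-identityˡ _)) ⟩
      unit n - (tail a ∗ approximation a n′) n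
        ≡⟨ cong (λ z → unit n - z) (∗-tail-cong a n 1≤n λ j 1≤j j<n → approximation-stable a n′ j j 1≤j (ℕₚ.≤-pred j<n) ℕₚ.≤-refl) ⟩
      unit n - (tail a ∗ b) n
        ∎

    inverse-isDirichletInverse : IsDirichletInverse a b
    inverse-isDirichletInverse n 1≤n = trans (∗-tail-split a b n 1≤n)
      (trans (cong (_+ (tail a ∗ b) n) (a₁*inverse n 1≤n)) (x-y+y≡x _ _))

  -- Weighted norms and summability of the inverse when κ < 1

  module _ (θ : ℝ) where

    weighted : Seq → Seq
    weighted c j = ∣ c j ∣ * ν θ j

    ν-* : ∀ {m n} → 1 ℕ.≤ m → 1 ℕ.≤ n → ν θ (m ℕ.* n) ≡ ν θ m * ν θ n
    ν-* {m} {n} 1≤m 1≤n = trans (cong (_^ (- θ)) (fromℕ-* m n)) (^-distribʳ-* (- θ) (fromℕ-pos 1≤m) (fromℕ-pos 1≤n))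

    ν-1 : ν θ 1 ≡ 1#
    ν-1 = trans (cong (_^ (- θ)) fromℕ-1) (1^ (- θ))

    -- The triangle inequality, with j^(-θ) completely multiplicative: the weight of n = r j is
    -- shared out between the two factors.
    weighted-∗ : ∀ c d n → 1 ℕ.≤ n → weighted (c ∗ d) n ≤ (weighted c ∗ weighted d) n
    weighted-∗ c d n 1≤n = begin
      ∣ (c ∗ d) n ∣ * ν θ n
        ≡⟨ cong (λ z → ∣ z ∣ * ν θ n) (∗-expand c d 1≤n ℕₚ.≤-refl) ⟩
      ∣ ∑ n (λ r → ∑ n (λ j → D r j * (c r * d j))) ∣ * ν θ n
        ≤⟨ *-monoˡ-≤ (<⇒≤ (^-pos _ _)) (≤-trans (∣∑∣≤∑∣∣ n _) (∑-mono-≤ n λ r _ _ → ∣∑∣≤∑∣∣ n _)) ⟩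
      ∑ n (λ r → ∑ n (λ j → ∣ D r j * (c r * d j) ∣)) * ν θ n
        ≡⟨ trans (sym (∑-*ʳ n (ν θ n) _)) (∑-cong n λ r _ _ → sym (∑-*ʳ n (ν θ n) _)) ⟩
      ∑ n (λ r → ∑ n (λ j → ∣ D r j * (c r * d j) ∣ * ν θ n))
        ≡⟨ ∑-cong n (λ r 1≤r _ → ∑-cong n λ j 1≤j _ → summand r j 1≤r 1≤j) ⟩
      ∑ n (λ r → ∑ n (λ j → D r j * (weighted c r * weighted d j)))
        ≡⟨ ∗-expand (weighted c) (weighted d) 1≤n ℕₚ.≤-refl ⟨
      (weighted c ∗ weighted d) n
        ∎
      where
      D : ℕ → ℕ → ℝ
      D r j = δ (r ℕ.* j) n
      summand : ∀ r j → 1 ℕ.≤ r → 1 ℕ.≤ j → ∣ D r j * (c r * d j) ∣ * ν θ n ≡ D r j * (weighted c r * weighted d j)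
      summand r j 1≤r 1≤j = begin-equality
        ∣ D r j * (c r * d j) ∣ * ν θ n
          ≡⟨ cong (_* ν θ n) (trans (∣x*y∣≡∣x∣*∣y∣ _ _) (cong₂ _*_ (0≤x⇒∣x∣≡x (0≤δ (r ℕ.* j) n)) (∣x*y∣≡∣x∣*∣y∣ _ _))) ⟩
        D r j * (∣ c r ∣ * ∣ d j ∣) * ν θ n
          ≡⟨ *-assoc _ _ _ ⟩
        D r j * (∣ c r ∣ * ∣ d j ∣ * ν θ n)
          -- The weights have to match only where r j = n; elsewhere both sides carry the factor 0.
          ≡⟨ δ*-cong {r ℕ.* j} (λ rj≡n → trans (cong (∣ c r ∣ * ∣ d j ∣ *_) (trans (cong (ν θ) (sym rj≡n)) (ν-* 1≤r 1≤j)))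
               (solve 4 (λ c d u v → c :* d :* (u :* v) := c :* u :* (d :* v)) refl ∣ c r ∣ ∣ d j ∣ (ν θ r) (ν θ j))) ⟩
        D r j * (weighted c r * weighted d j)
          ∎

    ∑unit≤1 : ∀ N → ∑ N unit ≤ 1#
    ∑unit≤1 zero    = <⇒≤ 0<1
    ∑unit≤1 (suc N) = reflexive (trans (∑-head N unit)
      (trans (cong (1# +_) (∑-zero N λ { (suc j) _ _ → refl })) (+-identityʳ 1#)))

    module _ {a : Seq} (a₁≢0 : a 1 ≢ 0#) where

      private
        b : Seq
        b = inverse a

      -- Absolute values in the fixed-point equation a₁ b = e - tail a ∗ b, coefficient by
      -- coefficient; summing over `n` gives the self-referential bound for the partial sums.
      inverse-bound : ∀ n → 1 ℕ.≤ n → ∣ a 1 ∣ * weighted b n ≤ unit n + (weighted (tail a) ∗ weighted b) n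
      inverse-bound n 1≤n = begin
        ∣ a 1 ∣ * (∣ b n ∣ * ν θ n)
          ≡⟨ trans (sym (*-assoc _ _ _)) (cong (_* ν θ n) (trans (sym (∣x*y∣≡∣x∣*∣y∣ _ _)) (cong ∣_∣ (a₁*inverse a₁≢0 n 1≤n)))) ⟩
        ∣ unit n - (tail a ∗ b) n ∣ * ν θ n
          ≤⟨ *-monoˡ-≤ (<⇒≤ (^-pos _ _)) (≤-trans (∣x+y∣≤∣x∣+∣y∣ _ _) (+-monoʳ-≤ _ (reflexive (∣-x∣≡∣x∣ _)))) ⟩
        (∣ unit n ∣ + ∣ (tail a ∗ b) n ∣) * ν θ n
          ≡⟨ trans (distribʳ _ _ _) (cong (_+ weighted (tail a ∗ b) n) (weighted-unit n 1≤n)) ⟩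
        unit n + weighted (tail a ∗ b) n
          ≤⟨ +-monoʳ-≤ (unit n) (weighted-∗ (tail a) b n 1≤n) ⟩
        unit n + (weighted (tail a) ∗ weighted b) n
          ∎
        where
        weighted-unit : ∀ n → 1 ℕ.≤ n → weighted unit n ≡ unit n
        weighted-unit 1             _ = trans (cong₂ _*_ (0≤x⇒∣x∣≡x (<⇒≤ 0<1)) ν-1) (*-identityˡ 1#)
        weighted-unit (suc (suc n)) _ = trans (cong (_* ν θ (suc (suc n))) ∣0∣≡0) (zeroˡ _)

      κ<1⇒inverse∈ℓ¹ : a ∈ℓ¹ θ → κ θ a < 1# → b ∈ℓ¹ θ
      -- Here `K` is |a₁| κ_θ, and `B` is the solution of |a₁| B = 1 + K B.
      κ<1⇒inverse∈ℓ¹ (S , hasSum) κ<1 = bounded⇒HasSum {B = 1# / (∣ a 1 ∣ - K)} (0≤∣c∣ν θ b) λ N →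
        y*z≤x⇒y≤x/z (x<y⇒0<y-x K<∣a₁∣) (begin
          ∑ N β * (∣ a 1 ∣ - K)
            ≡⟨ solve 3 (λ s a k → s :* (a :- k) := a :* s :- k :* s) refl (∑ N β) ∣ a 1 ∣ K ⟩
          ∣ a 1 ∣ * ∑ N β - K * ∑ N β
            ≤⟨ x≤y+z⇒x-y≤z (≤-trans (recursive N) (reflexive (+-comm 1# _))) ⟩
          1#
            ∎)
        where
        α β σ : Seq
        α = weighted (tail a)
        β = weighted b
        σ j = ∣ a (suc j) ∣ / fromℕ (suc j) ^ θ
        σ≡ : ∀ j → σ j ≡ weighted a (suc j)
        σ≡ j = cong (∣ a (suc j) ∣ *_) (sym (^-neg (fromℕ (suc j)) θ))
        0≤σ : ∀ j → 0# ≤ σ j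
        0≤σ j = subst (0# ≤_) (sym (σ≡ j)) (0≤∣c∣ν θ a (suc j))
        σ-bounded : ∀ n → ∑ n σ ≤ S
        σ-bounded n = begin
          ∑ n σ                              ≡⟨ ∑-cong n (λ j _ _ → σ≡ j) ⟩
          ∑ n (weighted a ∘ suc)             ≡⟨ +-identityˡ _ ⟨
          0# + ∑ n (weighted a ∘ suc)        ≤⟨ +-monoˡ-≤ _ (0≤∣c∣ν θ a 1) ⟩
          weighted a 1 + ∑ n (weighted a ∘ suc)  ≡⟨ ∑-head n (weighted a) ⟨
          ∑ (suc n) (weighted a)             ≤⟨ ∑≤HasSum (0≤∣c∣ν θ a) hasSum (suc n) ⟩
          S                                  ∎
        K : ℝ
        K = ∑∞ σ
        -- `∑∞` has a junk value on divergent series, so convergence, inherited from `a ∈ℓ¹ θ`, must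
        -- be known before `K` can be treated as the sum.
        σ-hasSum : HasSum σ K
        σ-hasSum = the-satisfies {HasSum σ} (bounded⇒HasSum 0≤σ σ-bounded)
        K<∣a₁∣ : K < ∣ a 1 ∣
        K<∣a₁∣ = subst₂ _<_ (trans (solve 3 (λ i k a → i :* k :* a := k :* (a :* i)) refl (∣ a 1 ∣ ⁻¹) K ∣ a 1 ∣)
            (trans (cong (K *_) (⁻¹-inverseʳ _ (pos⇒≢0 0<∣a₁∣))) (*-identityʳ K)))
          (*-identityˡ _) (*-monoˡ-< 0<∣a₁∣ κ<1)
          where 0<∣a₁∣ = x≢0⇒0<∣x∣ a₁≢0
        ∑α≤K : ∀ N → ∑ N α ≤ K
        ∑α≤K zero    = ∑≤HasSum 0≤σ σ-hasSum 0
        ∑α≤K (suc N) = begin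
          ∑ (suc N) α           ≡⟨ ∑-head N α ⟩
          α 1 + ∑ N (α ∘ suc)   ≡⟨ cong₂ _+_ (trans (cong (_* ν θ 1) ∣0∣≡0) (zeroˡ _))
                                     (∑-cong N λ { (suc j) _ _ → sym (σ≡ (suc j)) }) ⟩
          0# + ∑ N σ            ≡⟨ +-identityˡ _ ⟩
          ∑ N σ                 ≤⟨ ∑≤HasSum 0≤σ σ-hasSum N ⟩
          K                     ∎
        recursive : ∀ N → ∣ a 1 ∣ * ∑ N β ≤ 1# + K * ∑ N β
        recursive N = begin
          ∣ a 1 ∣ * ∑ N β                      ≡⟨ ∑-*ˡ N ∣ a 1 ∣ β ⟨
          ∑ N (λ n → ∣ a 1 ∣ * β n)            ≤⟨ ∑-mono-≤ N (λ n 1≤n _ → inverse-bound n 1≤n) ⟩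
          ∑ N (λ n → unit n + (α ∗ β) n)       ≡⟨ ∑-+ N unit (α ∗ β) ⟩
          ∑ N unit + ∑ N (α ∗ β)               ≤⟨ +-mono-≤ (∑unit≤1 N) (≤-trans (∑-∗-≤ (0≤∣c∣ν θ (tail a)) (0≤∣c∣ν θ b) N)
                                                    (*-monoˡ-≤ (∑-nonNeg N (0≤∣c∣ν θ b)) (∑α≤K N))) ⟩
          1# + K * ∑ N β                       ∎

theorem21 : (em : ExcludedMiddle 0ℓ) (R : CompleteOrderedField) →
    let open Analysis em R in
    (θ : ℝ) → 0# < θ →
    (w : Seq) →
    let a = differences w in
    a 1 ≢ 0# → a ∈ℓ¹ θ →
    ((b : Seq) → IsDirichletInverse a b → b ∈ℓ¹ θ →
    (m : ℝ) → 0# ≤ m →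
    ((λ x → fromℕ (π x) - Li x) =O (λ x → x ^ θ * log (e * x) ^ m))
    ⇔
    ((λ x → 𝒯 w x - ℳ w x) =O (λ x → x ^ θ * log (e * x) ^ m)))
    ×
    (κ θ a < 1# → ∃ λ b → IsDirichletInverse a b × b ∈ℓ¹ θ)
theorem21 em R θ _ w a₁≢0 a∈ℓ¹ =
  (λ b a∗b≡unit b∈ℓ¹ m 0≤m → mk⇔
    (transfer {θ} {m} {Δ} {E} {a} 0≤m a∈ℓ¹ Δ-vanish E≡)
    (transfer {θ} {m} {E} {Δ} {b} 0≤m b∈ℓ¹ (transform-vanish {Δ} {E} {a} Δ-vanish E≡)
      (inversion {Δ} {E} {a} {b} Δ-vanish a∗b≡unit E≡))) ,
  λ κ<1 → inverse a , inverse-isDirichletInverse a₁≢0 , κ<1⇒inverse∈ℓ¹ θ a₁≢0 a∈ℓ¹ κ<1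
  where
  open DirichletInverse em R
  a : Seq
  a = differences w
  E : ℝ → ℝ
  E x = 𝒯 w x - ℳ w x
  E≡ : E DirichletTransformOf Δ by a
  E≡ = 𝒯-ℳ≡∑ w
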